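{- Let $P=\sigma_1$-$\sigma_2$-$\sigma_3$-$\sigma_4$ and $Q=\sigma_1$-$\sigma_2\sigma_3$-$\sigma_4$ be two nontrivial partially ordered generalized patterns, where $\sigma_2$ and $\sigma_3$ are (nonempty and) contiguous, and assume that the rightmost letter of $\sigma_2$ is less than or equal to the leftmost letter of $\sigma_3$. Then $\mathrm{Av}(P)=\mathrm{Av}(Q)$ if and only if $P$ has at least one of the following properties: (1) $\sigma_2=1\dots1$, $\sigma_3=2$, and $P'\in\{1,2\}^*$. (2) $\sigma_2=1$, $\sigma_3=2\dots2$, and $P'\in\{1,2\}^*$. (3) $\sigma_2=2\dots21$, $\sigma_3=2\dots2$, $P'\in\{1,2\}^*$ and the letter $1$ appears exactly once in $P$. (4) $\sigma_2=1\dots1$, $\sigma_3=21\dots1$, $P'\in\{1,2\}^*$ and the letter $2$ appears exactly once in $P$. (5) $\sigma_2=1\dots1$, $\sigma_3=3$, $P'\in\{1,2,3\}^*$ and the letter $2$ appears exactly once in $P$. (6) $\sigma_2=1$, $\sigma_3=3\dots3$, $P'\in\{1,2,3\}^*$ and the letter $2$ appears exactly once in $P$.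
   Context: A permutation of length $n$ is a word containing each element of $\{1,\dots,n\}$ exactly once; $\mathcal{S}$ is the set of all permutations of all lengths $n\ge0$. A partially ordered generalized pattern $P$ is a nonempty word $p_1p_2\dots p_m$ of positive integers (repetitions allowed), whose set of letters is $\{1,2,\dots,r\}$ for some $r$, with a dash written between some of the consecutive letters. $P'$ denotes the word $p_1\dots p_m$ obtained from $P$ by removing all dashes. An occurrence of $P$ in a permutation $\pi=a_1\dots a_n$ is a subsequence $a_{k_1}\dots a_{k_m}$, $k_1<\dots<k_m$, such that (a) $p_i>p_j$ implies $a_{k_i}>a_{k_j}$ for all $i,j$ (no condition when $p_i=p_j$), and (b) $k_{i+1}=k_i+1$ whenever $p_i$ and $p_{i+1}$ are not separated by a dash. $\mathrm{Av}(P)$ is the set of permutations in $\mathcal{S}$ with no occurrence of $P$. A pattern is nontrivial if it does not consist only of the letter $1$. A pattern segment is contiguous if it contains no dash. Here $\sigma_1,\dots,\sigma_4$ are the segments making up $P$; $\sigma_1$ and $\sigma_4$ may themselves contain dashes and may be empty (in which case the adjoining dash is omitted); $Q$ is $P$ with the dash between $\sigma_2$ and $\sigma_3$ removed. $1\dots1$ denotes a string of one or more $1$'s, and similarly for $2\dots2$, $3\dots3$ (so $2\dots21$ is one or more $2$'s followed by a $1$, and $21\dots1$ is a $2$ followed by one or more $1$'s). For a set $A$ of letters, $A^*$ denotes the set of all strings over $A$. -}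

module Defs where

open import Data.Fin.Base as Fin using (Fin; toℕ)
open import Data.Fin.Permutation using (Permutation′; _⟨$⟩ʳ_)
open import Data.List.Base as List using (List; []; _∷_; concatMap; filter; length; lookup)
open import Data.List.Membership.Propositional using (_∈_)
open import Data.List.NonEmpty.Base as List⁺ using (List⁺; toList) renaming (_∷_ to _∷⁺_)
open import Data.List.Relation.Unary.All using (All)
open import Data.Nat.Base using (ℕ; suc; _≤_; _>_)
open import Data.Nat.Properties using (_≟_)
open import Data.Product.Base using (∃; _×_; _,_; proj₁; proj₂)
open import Function.Bundles using (_⇔_)
open import Level using (0ℓ)
open import Relation.Binary.PropositionalEquality using (_≡_)
open import Relation.Nullary.Negation using (¬_)
open import Relation.Unary using (Pred)

-- A permutation a₁…aₙ is a bijection on Fin n.  Positions and values are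
-- counted from 0 rather than 1; only their order and adjacency matter.

𝒮 : Set
𝒮 = ∃ Permutation′

-- A dashed word is given by its maximal contiguous segments: the dashes are
-- exactly the boundaries between consecutive segments.

Segment : Set
Segment = List⁺ ℕ

DashedWord : Set
DashedWord = List⁺ Segment

-- How a letter is linked to the next letter of the word.  The final letter,
-- which has no successor, is tagged `dash`; nothing depends on that tag.

data Link : Set where
  joined dash : Link

tag : ℕ → List ℕ → List (ℕ × Link)
tag x []       = (x , dash) ∷ []
tag x (y ∷ ys) = (x , joined) ∷ tag y ys

tagged : DashedWord → List (ℕ × Link)
tagged P = concatMap (λ σ → tag (List⁺.head σ) (List⁺.tail σ)) (toList P)

undash : DashedWord → List ℕ
undash P = List.map proj₁ (tagged P)

IsPattern : DashedWord → Set
IsPattern P = ∃ λ r → ∀ x → x ∈ undash P ⇔ (1 ≤ x × x ≤ r)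

Nontrivial : DashedWord → Set
Nontrivial P = ¬ All (_≡ 1) (undash P)

Position : DashedWord → Set
Position P = Fin (length (tagged P))

letter : (P : DashedWord) → Position P → ℕ
letter P i = proj₁ (lookup (tagged P) i)

link : (P : DashedWord) → Position P → Link
link P i = proj₂ (lookup (tagged P) i)

record Occurrence (P : DashedWord) {n : ℕ} (π : Permutation′ n) : Set where
  field
    k          : Position P → Fin n
    increasing : ∀ i j → i Fin.< j → k i Fin.< k j
    order      : ∀ i j → letter P i > letter P j →
                 (π ⟨$⟩ʳ k i) Fin.> (π ⟨$⟩ʳ k j)
    adjacent   : ∀ i j → toℕ j ≡ suc (toℕ i) → link P i ≡ joined →
                 toℕ (k j) ≡ suc (toℕ (k i))

Av : DashedWord → Pred 𝒮 0ℓ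
Av P (n , π) = ¬ Occurrence P π

Run : ℕ → Segment → Set
Run x σ = ∃ λ a → σ ≡ x ∷⁺ List.replicate a x

Once : ℕ → List ℕ → Set
Once x w = length (filter (x ≟_) w) ≡ 1

module _ (σ₁ : List Segment) (σ₂ σ₃ : Segment) (σ₄ : List Segment) where

  dashed : DashedWord
  dashed = σ₁ List⁺.++⁺ (σ₂ ∷⁺ σ₃ ∷ σ₄)

  merged : DashedWord
  merged = σ₁ List⁺.++⁺ ((σ₂ List⁺.⁺++⁺ σ₃) ∷⁺ σ₄)

{-# OPTIONS --safe #-}

-- Let g be the last position of σ₂.  An occurrence of Q is one of P that closes
-- the gap after g, so Av P ⊆ Av Q, and everything is about Av Q ⊆ Av P.
--
-- Under (1)–(6) an occurrence of P is repaired by sliding σ₂ right and σ₃ left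
-- until they meet.  In (1), (2), (5), (6) the meeting point is a step from a
-- value playing 1 to one playing the largest letter; in (3) and (4) it is an
-- extreme value of the gap, which takes over the unique 1 (resp. 2).
--
-- Conversely, insert one value x into the gap of a permutation realising P.  An
-- occurrence of Q misses a single position, so x plays the last letter of σ₂ or
-- the first letter of σ₃.  For x maximal or minimal this forces these letters to
-- be 1 and r, the largest letter.  If r ≥ 3, an x next to an element playing 2
-- shows that r = 3, that the 2 is unique and that σ₂ and σ₃ are constant.  If
-- r = 2, an extremal x, with the element next to it at the bottom or top of its
-- class, leaves only the shapes of σ₂ and σ₃ in (1)–(4).  Finally, inserting a
-- maximum followed by a minimum shows that constant σ₂ and σ₃ cannot both be
-- longer than 1.

module Submission where

open import Defs
open import Data.Empty using (⊥; ⊥-elim)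
open import Data.Fin.Base as Fin using (Fin; zero; suc; toℕ; fromℕ; fromℕ<; punchIn; punchOut)
open import Data.Fin.Permutation using (Permutation′; _⟨$⟩ʳ_; insert; id)
open import Data.Fin.Properties
  using (toℕ<n; toℕ-fromℕ<; toℕ-injective; punchInᵢ≢i; punchIn-punchOut; punchIn-cancel-≤; ≤fromℕ)
  renaming (_≟_ to _≟ᶠ_)
open import Data.List.Base
  using (List; []; _∷_; _++_; length; lookup; map; filter; replicate; concatMap)
open import Data.List.Membership.Propositional using (_∈_)
open import Data.List.NonEmpty.Base
  using (head; tail; last; toList; [_]; _++⁺_; snocView; _∷ʳ′_) renaming (_∷_ to _∷⁺_)
open import Data.List.Properties
  using (length-++; length-map; length-replicate; concatMap-++; filter-accept; filter-reject;
         ∷-injectiveˡ; ∷-injectiveʳ)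
open import Data.List.Relation.Unary.All as All using (All)
open import Data.List.Relation.Unary.Any using (here; there)
open import Data.Nat.Base hiding (compare)
open import Data.Nat.Properties
open import Data.Product.Base using (∃; _×_; _,_; proj₁; proj₂)
open import Data.Sum.Base using (_⊎_; inj₁; inj₂; [_,_]′)
open import Function.Base using (_∘_)
open import Function.Bundles using (_⇔_; mk⇔; module Equivalence; module Injection)
open import Function.Properties.Inverse using (↔⇒↣)
open import Relation.Binary.Definitions using (Total; Transitive; tri<; tri≈; tri>)
open import Relation.Binary.PropositionalEquality hiding ([_]; J)
open import Relation.Nullary using (¬_; Dec; yes; no; contradiction)
open import Relation.Nullary.Decidable using (_×-dec_)
open import Relation.Unary using (_≐_)

-- Embeddings and standardisation

-- ≺ is the order of values for occurrences in a permutation, and the weak order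
-- of keys for occurrences in a permutation that is only known to refine keys.
record Embedding (m : ℕ) (p : ℕ → ℕ) (J : ℕ → Set) (n : ℕ) (_≺_ : ℕ → ℕ → Set) : Set where
  field
    k          : ℕ → ℕ
    bounded    : ∀ {i} → i < m → k i < n
    increasing : ∀ {i j} → i < j → j < m → k i < k j
    order      : ∀ {i j} → i < m → j < m → p i < p j → k i ≺ k j
    adjacent   : ∀ {i} → suc i < m → J i → k (suc i) ≡ suc (k i)

at : {A : Set} → A → List A → ℕ → A
at d []       _       = d
at d (x ∷ xs) zero    = x
at d (x ∷ xs) (suc i) = at d xs i

at-lookup : ∀ {A : Set} {d : A} xs (i : Fin (length xs)) → at d xs (toℕ i) ≡ lookup xs i
at-lookup (x ∷ xs) zero    = refl
at-lookup (x ∷ xs) (suc i) = at-lookup xs i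

extend : ∀ {n} → (Fin n → ℕ) → ℕ → ℕ
extend {zero}  f _       = 0
extend {suc n} f zero    = f zero
extend {suc n} f (suc i) = extend (f ∘ suc) i

extend-toℕ : ∀ {n} (f : Fin n → ℕ) i → extend f (toℕ i) ≡ f i
extend-toℕ f zero    = refl
extend-toℕ f (suc i) = extend-toℕ (f ∘ suc) i

-- A view: matching on it replaces a bounded natural number by `toℕ` of an element of `Fin n`, so
-- that facts about `Fin` apply directly.
data InRange (n : ℕ) : ℕ → Set where
  inRange : (i : Fin n) → InRange n (toℕ i)

range : ∀ {n i} → i < n → InRange n i
range i<n = subst (InRange _) (toℕ-fromℕ< i<n) (inRange (fromℕ< i<n))

values : ∀ {n} → Permutation′ n → ℕ → ℕ
values π = extend (λ i → toℕ (π ⟨$⟩ʳ i))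

values-injective : ∀ {n} (π : Permutation′ n) {i j} → i < n → j < n →
                   values π i ≡ values π j → i ≡ j
values-injective π i<n j<n eq with range i<n | range j<n
... | inRange i | inRange j = cong toℕ (Injection.injective (↔⇒↣ π)
  (toℕ-injective (trans (sym (extend-toℕ _ i)) (trans eq (extend-toℕ _ j)))))

letterAt : List (ℕ × Link) → ℕ → ℕ
letterAt T i = proj₁ (at (0 , dash) T i)

linkAt : List (ℕ × Link) → ℕ → Link
linkAt T i = proj₂ (at (0 , dash) T i)

Below : ∀ {n} → Permutation′ n → ℕ → ℕ → Set
Below π a b = values π a < values π b

-- Occurrences as embeddings indexed by natural numbers

module _ (P : DashedWord) {n : ℕ} (π : Permutation′ n) where

  private
    T = tagged P

    letter-at : ∀ i → letterAt T (toℕ i) ≡ letter P i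
    letter-at i = cong proj₁ (at-lookup T i)

    link-at : ∀ i → linkAt T (toℕ i) ≡ link P i
    link-at i = cong proj₂ (at-lookup T i)

  occurrence⇒embedding : Occurrence P π →
    Embedding (length T) (letterAt T) (λ i → linkAt T i ≡ joined) n (Below π)
  occurrence⇒embedding O = record
    { k = κ ; bounded = bd ; increasing = inc ; order = ord ; adjacent = adj }
    where
    module O = Occurrence O
    κ : ℕ → ℕ
    κ = extend (toℕ ∘ O.k)
    κ-toℕ : ∀ i → κ (toℕ i) ≡ toℕ (O.k i)
    κ-toℕ = extend-toℕ (toℕ ∘ O.k)
    value : ∀ i → values π (κ (toℕ i)) ≡ toℕ (π ⟨$⟩ʳ O.k i)
    value i = trans (cong (values π) (κ-toℕ i)) (extend-toℕ _ (O.k i))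
    bd : ∀ {i} → i < length T → κ i < n
    bd i<m with range i<m
    ... | inRange i = subst (_< n) (sym (κ-toℕ i)) (toℕ<n (O.k i))
    inc : ∀ {i j} → i < j → j < length T → κ i < κ j
    inc i<j j<m with range (<-trans i<j j<m) | range j<m
    ... | inRange i | inRange j =
      subst₂ _<_ (sym (κ-toℕ i)) (sym (κ-toℕ j)) (O.increasing i j i<j)
    ord : ∀ {i j} → i < length T → j < length T → letterAt T i < letterAt T j → Below π (κ i) (κ j)
    ord i<m j<m lt with range i<m | range j<m
    ... | inRange i | inRange j = subst₂ _<_ (sym (value i)) (sym (value j))
      (O.order j i (subst₂ _<_ (letter-at i) (letter-at j) lt))
    adj : ∀ {i} → suc i < length T → linkAt T i ≡ joined → κ (suc i) ≡ suc (κ i)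
    adj {i′} i<m J = go (range (<-trans (n<1+n _) i<m)) (range i<m) refl refl J
      where
      -- `suc i′` cannot be unified with `toℕ j`, so the indices of the two views are generalised
      -- and tied back by equations.
      go : ∀ {a b} → InRange (length T) a → InRange (length T) b → a ≡ i′ → b ≡ suc i′ →
           linkAt T i′ ≡ joined → κ (suc i′) ≡ suc (κ i′)
      go (inRange i) (inRange j) refl eq J =
        trans (cong κ (sym eq)) (trans (κ-toℕ j)
          (trans (O.adjacent i j eq (trans (sym (link-at i)) J)) (cong suc (sym (κ-toℕ i)))))

  embedding⇒occurrence :
    Embedding (length T) (letterAt T) (λ i → linkAt T i ≡ joined) n (Below π) → Occurrence P π
  embedding⇒occurrence E = record
    { k          = κ
    ; increasing = λ i j i<j → subst₂ _<_ (sym (κ-toℕ i)) (sym (κ-toℕ j)) (E.increasing i<j (toℕ<n j))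
    ; order      = λ i j lt → subst₂ _<_ (value j) (value i)
        (E.order (toℕ<n j) (toℕ<n i) (subst₂ _<_ (sym (letter-at j)) (sym (letter-at i)) lt))
    ; adjacent   = λ i j eq J → trans (κ-toℕ j) (trans (cong E.k eq)
        (trans (E.adjacent (subst (_< length T) eq (toℕ<n j)) (trans (link-at i) J))
          (cong suc (sym (κ-toℕ i)))))
    }
    where
    module E = Embedding E
    κ : Position P → Fin n
    κ i = fromℕ< (E.bounded (toℕ<n i))
    κ-toℕ : ∀ i → toℕ (κ i) ≡ E.k (toℕ i)
    κ-toℕ i = toℕ-fromℕ< _
    value : ∀ i → values π (E.k (toℕ i)) ≡ toℕ (π ⟨$⟩ʳ κ i)
    value i = trans (cong (values π) (sym (κ-toℕ i))) (extend-toℕ _ (κ i))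

argmax : ∀ {n} (u : Fin (suc n) → ℕ) → ∃ λ q → ∀ i → u i ≤ u q
argmax {zero}  u = zero , λ { zero → ≤-refl }
argmax {suc n} u with argmax (u ∘ suc)
... | q , q-max with u zero ≤? u (suc q)
...   | yes u0≤ = suc q , λ { zero → u0≤ ; (suc i) → q-max i }
...   | no  u0≰ = zero , λ { zero → ≤-refl ; (suc i) → ≤-trans (q-max i) (<⇒≤ (≰⇒> u0≰)) }

-- A position of maximal key receives the top value, and the remaining positions are treated
-- recursively. Equal keys may end up in either order, so only strict inequalities are promised.
standardise : ∀ {n} (u : Fin n → ℕ) →
              ∃ λ (π : Permutation′ n) → ∀ i j → u i < u j → (π ⟨$⟩ʳ i) Fin.< (π ⟨$⟩ʳ j)
standardise {zero}  u = id , λ ()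
standardise {suc n} u with argmax u
... | q , q-max with standardise (u ∘ punchIn q)
...   | π , mono = insert q (fromℕ n) π , mono′
  where
  mono′ : ∀ i j → u i < u j → (insert q (fromℕ n) π ⟨$⟩ʳ i) Fin.< (insert q (fromℕ n) π ⟨$⟩ʳ j)
  mono′ i j lt with q ≟ᶠ i | q ≟ᶠ j
  ... | yes refl | _ = contradiction (q-max j) (<⇒≱ lt)
  ... | no q≢i | yes refl = ≤∧≢⇒< (≤fromℕ _)
    (punchInᵢ≢i (fromℕ n) (π ⟨$⟩ʳ punchOut q≢i) ∘ toℕ-injective)
  ... | no q≢i | no q≢j =
    ≰⇒> (<⇒≱ (mono (punchOut q≢i) (punchOut q≢j)
          (subst₂ _<_ (cong u (sym (punchIn-punchOut q≢i))) (cong u (sym (punchIn-punchOut q≢j))) lt))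
        ∘ punchIn-cancel-≤ (fromℕ n) _ _)

values-standardise : ∀ n (u : ℕ → ℕ) → ∃ λ (π : Permutation′ n) →
                     ∀ {i j} → i < n → j < n → u i < u j → Below π i j
values-standardise n u with standardise (u ∘ toℕ)
... | π , mono = π , λ i<n j<n → go (range i<n) (range j<n)
  where
  go : ∀ {i j} → InRange n i → InRange n j → u i < u j → Below π i j
  go (inRange i) (inRange j) lt =
    subst₂ _<_ (sym (extend-toℕ _ i)) (sym (extend-toℕ _ j)) (mono i j lt)

-- How far an embedding can displace positions

module _ {m p J n R} (E : Embedding m p J n R) where

  open Embedding E

  -- Strict growth gives k j - k i ≥ j - i; the additive form avoids truncated subtraction.
  spread : ∀ {i j} → i ≤ j → j < m → k i + j ≤ k j + i
  spread {i} i≤j = go (≤⇒≤′ i≤j)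
    where
    go : ∀ {j} → i ≤′ j → j < m → k i + j ≤ k j + i
    go ≤′-refl           _   = ≤-refl
    go (≤′-step {j} i≤j) j<m =
      ≤-trans (≤-reflexive (+-suc (k i) j))
        (≤-trans (s≤s (go i≤j (<-trans (n<1+n j) j<m))) (+-monoˡ-≤ i (increasing (n<1+n j) j<m)))

  -- On a joined block `spread` becomes an equality: the block is translated.
  run : ∀ {a b i j} → (∀ {l} → a ≤ l → l < b → J l) → b < m →
        a ≤ i → i ≤ j → j ≤ b → k i + j ≡ k j + i
  run {a} {b} {i} J-run b<m a≤i i≤j = go (≤⇒≤′ i≤j)
    where
    go : ∀ {j} → i ≤′ j → j ≤ b → k i + j ≡ k j + i
    go ≤′-refl           _   = refl
    go (≤′-step {j} i≤j) j<b = trans (+-suc (k i) j)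
      (trans (cong suc (go i≤j (<⇒≤ j<b)))
        (cong (_+ i) (sym (adjacent (≤-<-trans j<b b<m) (J-run (≤-trans a≤i (≤′⇒≤ i≤j)) j<b)))))

  i≤ki : ∀ {i} → i < m → i ≤ k i
  i≤ki i<m = ≤-trans (m≤n+m _ (k 0)) (≤-trans (spread z≤n i<m) (≤-reflexive (+-identityʳ _)))

  -- Room must remain for the positions after `i`. Together with `i≤ki` this bounds every
  -- displacement by n - m, hence by 1 after a single insertion.
  ki≤ : ∀ {i} → i < m → k i + m ≤ n + i
  ki≤ {i} (s≤s {n = m′} i≤m′) = ≤-trans (≤-reflexive (+-suc (k i) m′))
    (≤-trans (s≤s (spread i≤m′ ≤-refl)) (+-monoˡ-≤ i (bounded ≤-refl)))

  k-injective : ∀ {i j} → i < m → j < m → k i ≡ k j → i ≡ j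
  k-injective {i} {j} i<m j<m eq with <-cmp i j
  ... | tri< i<j _ _ = contradiction eq (<⇒≢ (increasing i<j j<m))
  ... | tri≈ _ i≡j _ = i≡j
  ... | tri> _ _ j<i = contradiction (sym eq) (<⇒≢ (increasing j<i i<m))

-- Necessity

-- The increasing enumeration of the numbers other than `c`: `punchIn` carried over to ℕ.
skip : ℕ → ℕ → ℕ
skip zero    i       = suc i
skip (suc c) zero    = zero
skip (suc c) (suc i) = suc (skip c i)

skip-< : ∀ {c i} → i < c → skip c i ≡ i
skip-< {suc c} {zero}  _         = refl
skip-< {suc c} {suc i} (s≤s i<c) = cong suc (skip-< i<c)

skip-≥ : ∀ {c i} → c ≤ i → skip c i ≡ suc i
skip-≥ {zero}  {i}     _         = refl
skip-≥ {suc c} {suc i} (s≤s c≤i) = cong suc (skip-≥ c≤i)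

skip-mono-< : ∀ c {i j} → i < j → skip c i < skip c j
skip-mono-< zero    i<j                             = s≤s i<j
skip-mono-< (suc c) {zero}  {suc j} _               = s≤s z≤n
skip-mono-< (suc c) {suc i} {suc j} (s≤s i<j)       = s≤s (skip-mono-< c i<j)

skip-bounded : ∀ c {i m} → i < m → skip c i < suc m
skip-bounded zero    i<m                          = s≤s i<m
skip-bounded (suc c) {zero}  i<m                  = s≤s z≤n
skip-bounded (suc c) {suc i} {suc m} (s≤s i<m)    = s≤s (skip-bounded c i<m)

skip-suc : ∀ c {i} → suc i ≢ c → skip c (suc i) ≡ suc (skip c i)
skip-suc zero                 _  = refl
skip-suc (suc zero)    {zero} ≢  = contradiction refl ≢
skip-suc (suc (suc c)) {zero} _  = refl
skip-suc (suc c)      {suc i} ≢  = cong suc (skip-suc c (≢ ∘ cong suc))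

unskip : ∀ c {q m} → c ≤ m → q < suc m → q ≢ c → ∃ λ i → i < m × q ≡ skip c i
unskip c {q} c≤m q≤m q≢c with <-cmp q c
... | tri< q<c _ _ = q , <-≤-trans q<c c≤m , sym (skip-< q<c)
... | tri≈ _ q≡c _ = contradiction q≡c q≢c
... | tri> _ _ (s≤s {n = q′} c≤q′) = q′ , s≤s⁻¹ q≤m , sym (skip-≥ c≤q′)

ins : {A : Set} → ℕ → A → (ℕ → A) → ℕ → A
ins zero    x f zero    = x
ins zero    x f (suc q) = f q
ins (suc c) x f zero    = f zero
ins (suc c) x f (suc q) = ins c x (f ∘ suc) q

ins-at : ∀ {A : Set} c {x : A} f → ins c x f c ≡ x
ins-at zero    f = refl
ins-at (suc c) f = ins-at c (f ∘ suc)

ins-skip : ∀ {A : Set} c {x : A} f i → ins c x f (skip c i) ≡ f i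
ins-skip zero    f i       = refl
ins-skip (suc c) f zero    = refl
ins-skip (suc c) f (suc i) = ins-skip c (f ∘ suc) i

override : ℕ → ℕ → ℕ → ℕ
override z c i with i ≟ z
... | yes _ = c
... | no  _ = 2

override-at : ∀ {z c} → override z c z ≡ c
override-at {z} with z ≟ z
... | yes _   = refl
... | no  z≢z = contradiction refl z≢z

override-off : ∀ {z c i} → i ≢ z → override z c i ≡ 2
override-off {z} {c} {i} i≢z with i ≟ z
... | yes i≡z = contradiction i≡z i≢z
... | no  _   = refl

override-≤ : ∀ {z c} i → c ≤ 4 → override z c i ≤ 4
override-≤ {z} i c≤4 with i ≟ z
... | yes _ = c≤4
... | no  _ = s≤s (s≤s z≤n)

-- Five levels per letter: offset 2 is the default, so offset c = 0 or 4 at z puts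
-- that element at the bottom or top of its class, and leaves room for an
-- inserted value right next to it.
key : (ℕ → ℕ) → ℕ → ℕ → ℕ → ℕ
key p z c i = 5 * p i + override z c i

key-at : ∀ p {z} c → key p z c z ≡ 5 * p z + c
key-at p {z} c = cong (5 * p z +_) override-at

key-off : ∀ p {z} c {i} → i ≢ z → key p z c i ≡ 5 * p i + 2
key-off p c {i} i≢z = cong (5 * p i +_) (override-off i≢z)

key-≥ : ∀ p {z c a} i → a ≤ p i → 5 * a ≤ key p z c i
key-≥ p i a≤ = ≤-trans (*-monoʳ-≤ 5 a≤) (m≤m+n _ _)

key-≤ : ∀ p {z c a} i → c ≤ 4 → p i ≤ a → key p z c i ≤ 5 * a + 4
key-≤ p i c≤4 ≤a = +-mono-≤ (*-monoʳ-≤ 5 ≤a) (override-≤ i c≤4)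

-- Letters are scaled by 5 and offsets are at most 4, so an offset never overturns a strict
-- inequality of letters.
key-mono-< : ∀ p {z c i j} → c ≤ 4 → p i < p j → key p z c i < key p z c j
key-mono-< p {z} {c} {i} {j} c≤4 lt = ≤-trans
  (≤-trans (s≤s (key-≤ p i c≤4 ≤-refl)) (≤-reflexive eq))
  (key-≥ p j lt)
  where
  eq : suc (5 * p i + 4) ≡ 5 * suc (p i)
  eq = trans (sym (+-suc (5 * p i) 4)) (trans (+-comm (5 * p i) 5) (sym (*-suc 5 (p i))))

predecessor : ∀ {a b} → a < b → ∃ λ h → suc h ≡ b × a ≤ h
predecessor (s≤s {n = h} a≤h) = h , refl , a≤h

descend : (P : ℕ → Set) → ∀ {a b} → a ≤ b → P b →
          (∀ {l} → a ≤ l → l < b → P (suc l) → P l) → P a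
descend P {a} = go ∘ ≤⇒≤′
  where
  go : ∀ {b} → a ≤′ b → P b → (∀ {l} → a ≤ l → l < b → P (suc l) → P l) → P a
  go ≤′-refl       Pa _    = Pa
  go (≤′-step a≤b) Pb step = go a≤b (step (≤′⇒≤ a≤b) ≤-refl Pb) λ a≤l l<b → step a≤l (m≤n⇒m≤1+n l<b)

ascend : (P : ℕ → Set) → ∀ {a b} → a ≤ b → P a →
         (∀ {l} → a ≤ l → l < b → P l → P (suc l)) → P b
ascend P {a} = go ∘ ≤⇒≤′
  where
  go : ∀ {b} → a ≤′ b → P a → (∀ {l} → a ≤ l → l < b → P l → P (suc l)) → P b
  go ≤′-refl       Pa _    = Pa
  go (≤′-step a≤b) Pa step =
    step (≤′⇒≤ a≤b) ≤-refl (go a≤b Pa λ a≤l l<b → step a≤l (m≤n⇒m≤1+n l<b))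

-- Positions `s` to `g` carry σ₂, positions `suc g` to `e` carry σ₃. `forced` is Av Q ⊆ Av P, tested
-- on a permutation refining the keys `u`. Its double negation reflects that avoidance is a
-- negation; every use ends in a contradiction.
module OnlyIf
  {m g s e : ℕ} {p : ℕ → ℕ} {J : ℕ → Set}
  (s≤g : s ≤ g) (g<e : g < e) (e<m : e < m)
  (J₂ : ∀ {i} → s ≤ i → i < g → J i)
  (J₃ : ∀ {i} → suc g ≤ i → i < e → J i)
  (¬Jg : ¬ J g)
  (forced : ∀ n (u : ℕ → ℕ) → Embedding m p J n (λ a b → u a < u b) →
            ¬ ¬ Embedding m p (λ i → J i ⊎ i ≡ g) n (λ a b → u a ≤ u b))
  {r : ℕ}
  (p≥1 : ∀ {i} → i < m → 1 ≤ p i) (p≤r : ∀ {i} → i < m → p i ≤ r)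
  (attained : ∀ {c} → 1 ≤ c → c ≤ r → ∃ λ i → i < m × p i ≡ c)
  (1<r : 1 < r)
  where

  private
    g<m : g < m
    g<m = <-trans g<e e<m

    1+g<m : suc g < m
    1+g<m = ≤-<-trans g<e e<m

    J≢ : ∀ {i} → J i → suc i ≢ suc g
    J≢ J refl = ¬Jg J

    c = suc g

  -- An occurrence of Q after `x` is inserted at place `suc g`. There is one place to spare, so each
  -- position stays or moves up by one. As `g` and `suc g` are now joined, either `g` moves and
  -- plays `x` (`Left`), or it stays and `suc g` plays `x` (`Right`).
  module Probe (z o x : ℕ) (E : Embedding m p (λ i → J i ⊎ i ≡ g) (suc m)
                 (λ a b → ins (suc g) x (key p z o) a ≤ ins (suc g) x (key p z o) b)) where

    open Embedding E public

    U : ℕ → ℕ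
    U i = ins (suc g) x (key p z o) (k i)

    k-next : k (suc g) ≡ suc (k g)
    k-next = adjacent 1+g<m (inj₂ refl)

    k≤ : ∀ {i} → i < m → k i ≤ suc i
    k≤ {i} i<m = +-cancelʳ-≤ m (k i) (suc i)
      (≤-trans (ki≤ E i<m) (≤-reflexive (cong suc (+-comm m i))))

    k≥ : ∀ {i} → i < m → i ≤ k i
    k≥ = i≤ki E

    k-≢ : ∀ {i} → i < m → k i ≢ i → k i ≡ suc i
    k-≢ i<m ≢ = ≤-antisym (k≤ i<m) (≤∧≢⇒< (k≥ i<m) (≢ ∘ sym))

    k-≢suc : ∀ {i} → i < m → k i ≢ suc i → k i ≡ i
    k-≢suc i<m ≢ = ≤-antisym (s≤s⁻¹ (≤∧≢⇒< (k≤ i<m) ≢)) (k≥ i<m)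

    U-skip : ∀ {i l} → k i ≡ skip (suc g) l → U i ≡ key p z o l
    U-skip {l = l} eq = trans (cong (ins (suc g) x (key p z o)) eq) (ins-skip (suc g) (key p z o) l)

    U-low : ∀ {i l} → k i ≡ l → l ≤ g → U i ≡ key p z o l
    U-low eq l≤g = U-skip (trans eq (sym (skip-< (s≤s l≤g))))

    U-high : ∀ {i l} → k i ≡ suc l → suc g ≤ l → U i ≡ key p z o l
    U-high eq g<l = U-skip (trans eq (sym (skip-≥ g<l)))

    U-x : ∀ {i} → k i ≡ suc g → U i ≡ x
    U-x eq = trans (cong (ins (suc g) x (key p z o)) eq) (ins-at (suc g) (key p z o))

    k-unskip : ∀ {i} → i < m → k i ≢ suc g → ∃ λ l → l < m × k i ≡ skip (suc g) l
    k-unskip i<m = unskip (suc g) (<⇒≤ 1+g<m) (bounded i<m)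

    U-key : ∀ {i} → i < m → k i ≢ suc g → ∃ λ l → l < m × U i ≡ key p z o l
    U-key i<m ≢ with k-unskip i<m ≢
    ... | l , l<m , eq = l , l<m , U-skip eq

    module Left (k-g : k g ≡ suc g) where

      k-σ₂ : ∀ {i} → s ≤ i → i ≤ g → k i ≡ suc i
      k-σ₂ {i} s≤i i≤g = +-cancelʳ-≡ g (k i) (suc i)
        (trans (run E (λ s≤l l<g → inj₁ (J₂ s≤l l<g)) g<m s≤i i≤g ≤-refl)
          (trans (cong (_+ i) k-g) (cong suc (+-comm g i))))

      U-g : U g ≡ x
      U-g = U-x k-g

      -- Since σ₂ moves as a block, each of its positions except the last plays the element of its
      -- successor.
      U-σ₂ : ∀ {i} → s ≤ i → i < g → U i ≡ key p z o (suc i)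
      U-σ₂ s≤i i<g = U-low (k-σ₂ s≤i (<⇒≤ i<g)) i<g

      U-above : ∀ {i} → g < i → i < m → U i ≡ key p z o i
      U-above g<i i<m = U-high (≤-antisym (k≤ i<m) (go (≤⇒≤′ g<i) i<m)) g<i
        where
        go : ∀ {i} → suc g ≤′ i → i < m → suc i ≤ k i
        go ≤′-refl        _   = ≤-reflexive (sym (trans k-next (cong suc k-g)))
        go (≤′-step g<i) i<m = ≤-<-trans (go g<i (<-trans (n<1+n _) i<m)) (increasing (n<1+n _) i<m)

      -- x plays 1, so elements playing a larger letter exceed x.  The element at y
      -- does not, which forces k to shift every position from y to g by one; hence
      -- all of them carry letters above 1, and so does g.
      below-x : (∀ {i} → i < m → p i ≤ 1 → key p z o i < x) → p g ≡ 1 →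
                ∀ {y} → y < m → 1 < p y → key p z o y < x → ⊥
      below-x ones pg≡1 {y} y<m 1<py y<x with <-≤-connex g y
      ... | inj₁ g<y = <⇒≱ y<x (subst₂ _≤_ U-g (U-above g<y y<m)
              (order g<m y<m (subst (_< p y) (sym pg≡1) 1<py)))
      ... | inj₂ y≤g = <⇒≢ (proj₁ (go (≤⇒≤′ y≤g) ≤-refl)) (sym pg≡1)
        where
        above : ∀ {i} → i < m → 1 < p i → x ≤ U i
        above {i} i<m 1<pi = subst (_≤ U i) U-g (order g<m i<m (subst (_< p _) (sym pg≡1) 1<pi))
        go : ∀ {i} → y ≤′ i → i ≤ g → 1 < p i × k i ≡ suc i
        go ≤′-refl i≤g = 1<py , k-≢ y<m λ k≡ → <⇒≱ y<x (subst (x ≤_) (U-low k≡ i≤g) (above y<m 1<py))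
        go (≤′-step {i} y≤i) i<g with go y≤i (<⇒≤ i<g)
        ... | 1<pi , k≡ = ≰⇒> not-one , ≤-antisym (k≤ (<-trans i<g+1 1+g<m))
            (subst (_< k (suc i)) k≡ (increasing (n<1+n i) (<-trans i<g+1 1+g<m)))
          where
          i<g+1 = s≤s i<g
          not-one : ¬ p (suc i) ≤ 1
          not-one p≤1 = <⇒≱ (ones (<-trans i<g+1 1+g<m) p≤1)
            (subst (x ≤_) (U-low k≡ i<g) (above (<-trans i<g g<m) 1<pi))

    module Right (k-g : k g ≡ g) where

      k-1+g : k (suc g) ≡ suc g
      k-1+g = trans k-next (cong suc k-g)

      k-σ₃ : ∀ {i} → suc g ≤ i → i ≤ e → k i ≡ i
      k-σ₃ {i} g<i i≤e = +-cancelʳ-≡ (suc g) (k i) i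
        (trans (sym (run E (λ g<l l<e → inj₁ (J₃ g<l l<e)) e<m ≤-refl g<i i≤e))
          (trans (cong (_+ i) k-1+g) (+-comm (suc g) i)))

      U-1+g : U (suc g) ≡ x
      U-1+g = U-x k-1+g

      -- Since σ₃ stays as a block, each of its positions except the first plays the element of its
      -- predecessor.
      U-σ₃ : ∀ {i} → suc g ≤ i → i < e → U (suc i) ≡ key p z o i
      U-σ₃ g<i i<e = U-high (k-σ₃ (m≤n⇒m≤1+n g<i) i<e) g<i

      U-below : ∀ {i} → i ≤ g → U i ≡ key p z o i
      U-below {i} i≤g = U-low (≤-antisym k≤i (k≥ (≤-<-trans i≤g g<m))) i≤g
        where
        k≤i : k i ≤ i
        k≤i = +-cancelʳ-≤ g (k i) i (≤-trans (spread E i≤g g<m)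
                (≤-reflexive (trans (cong (_+ i) k-g) (+-comm g i))))

      -- Mirror image of `below-x`. Here `x` plays `r`, so elements playing a smaller letter are at
      -- most `x`. The element at `y` is not, so no position from `suc g` to `y` moves; hence all of
      -- them carry letters below `r`, and so does `suc g`.
      above-x : (∀ {i} → i < m → r ≤ p i → x < key p z o i) → p (suc g) ≡ r →
                ∀ {y} → y < m → p y < r → x < key p z o y → ⊥
      above-x rs pg≡r {y} y<m py<r x<y with <-≤-connex g y
      ... | inj₂ y≤g = <⇒≱ x<y (subst₂ _≤_ (U-below y≤g) U-1+g
              (order y<m 1+g<m (subst (p y <_) (sym pg≡r) py<r)))
      ... | inj₁ g<y = <⇒≢ (proj₁ (go (≤⇒≤′ g<y) y<m py<r k-y)) pg≡r
        where
        below : ∀ {i} → i < m → p i < r → U i ≤ x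
        below {i} i<m pi<r = subst (U i ≤_) U-1+g (order i<m 1+g<m (subst (p _ <_) (sym pg≡r) pi<r))
        k-y : k y ≡ y
        k-y = k-≢suc y<m λ k≡ → <⇒≱ x<y (subst (_≤ x) (U-high k≡ g<y) (below y<m py<r))
        go : ∀ {i} → suc g ≤′ i → i < m → p i < r → k i ≡ i → p (suc g) < r × k (suc g) ≡ suc g
        go ≤′-refl i<m pi<r k≡ = pi<r , k≡
        go (≤′-step {i} g<i) i<m pi<r k≡ = go g<i (<-trans (n<1+n i) i<m) (≰⇒> not-r)
          (≤-antisym (s≤s⁻¹ (subst (k i <_) k≡ (increasing (n<1+n i) i<m))) (k≥ (<-trans (n<1+n i) i<m)))
          where
          not-r : ¬ r ≤ p i
          not-r r≤p = <⇒≱ (rs (<-trans (n<1+n i) i<m) r≤p)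
            (subst (_≤ x) (U-high k≡ (≤′⇒≤ g<i)) (below i<m pi<r))

    side : k g ≡ g ⊎ k g ≡ suc g
    side with k g ≟ g
    ... | yes k≡ = inj₁ k≡
    ... | no  k≢ = inj₂ (k-≢ g<m k≢)

    -- Some other position carries `r` and would have to play at least `x`, but every element
    -- besides `x` is smaller.
    not-max : (∀ {i} → i < m → key p z o i < x) → ∀ {i} → i < m → p i < r → k i ≢ suc g
    not-max max i<m pi<r k≡ with attained (<⇒≤ 1<r) ≤-refl
    ... | l , l<m , pl≡r with U-key l<m (λ k≡′ → <⇒≢ pi<r
                               (trans (cong p (k-injective E i<m l<m (trans k≡ (sym k≡′)))) pl≡r))
    ...   | l′ , l′<m , eq = <⇒≱ (max l′<m) (subst₂ _≤_ (U-x k≡) eq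
              (order i<m l<m (subst (p _ <_) (sym pl≡r) pi<r)))

    -- Dual to `not-max`: a position carrying 1 would have to play at most `x`.
    not-min : (∀ {i} → i < m → x < key p z o i) → ∀ {i} → i < m → 1 < p i → k i ≢ suc g
    not-min min i<m 1<pi k≡ with attained ≤-refl (<⇒≤ 1<r)
    ... | l , l<m , pl≡1 with U-key l<m (λ k≡′ → <⇒≢ 1<pi
                               (trans (sym pl≡1) (cong p (k-injective E l<m i<m (trans k≡′ (sym k≡))))))
    ...   | l′ , l′<m , eq = <⇒≱ (min l′<m) (subst₂ _≤_ eq (U-x k≡)
              (order l<m i<m (subst (_< p _) (sym pl≡1) 1<pi)))

  -- Inserting at `suc g` separates only `g` from `suc g`, where P has a dash, so `skip (suc g)` is
  -- an occurrence of P.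
  probe : ∀ z o x → o ≤ 4 → ¬ ¬ Embedding m p (λ i → J i ⊎ i ≡ g) (suc m)
            (λ a b → ins (suc g) x (key p z o) a ≤ ins (suc g) x (key p z o) b)
  probe z o x o≤4 = forced (suc m) (ins (suc g) x (key p z o)) record
    { k          = skip (suc g)
    ; bounded    = skip-bounded (suc g)
    ; increasing = λ i<j _ → skip-mono-< (suc g) i<j
    ; order      = λ {i} {j} _ _ lt → subst₂ _<_
        (sym (ins-skip (suc g) (key p z o) i)) (sym (ins-skip (suc g) (key p z o) j))
        (key-mono-< p o≤4 lt)
    ; adjacent   = λ _ J → skip-suc (suc g) (J≢ J)
    }

  -- Letters lie between 1 and `r` and offsets are at most 4, so all keys lie between 5 and
  -- `5 * r + 4`.
  max min : ℕ
  max = 5 * r + 5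
  min = 0

  key<max : ∀ {z o i} → o ≤ 4 → i < m → key p z o i < max
  key<max o≤4 i<m = ≤-trans (s≤s (key-≤ p _ o≤4 (p≤r i<m))) (≤-reflexive (sym (+-suc (5 * r) 4)))

  min<key : ∀ {z o i} → i < m → min < key p z o i
  min<key i<m = ≤-trans (s≤s z≤n) (key-≥ p _ (p≥1 i<m))

  private
    2≤4 : 2 ≤ 4
    2≤4 = s≤s (s≤s z≤n)

  -- If the letter at `suc g` were below `r`, so would be the one at `g`, and neither could play an
  -- inserted maximum. Dually, if the letter at `g` exceeded 1, neither could play an inserted
  -- minimum.
  extremes : p g ≤ p (suc g) → p g ≡ 1 × p (suc g) ≡ r
  extremes a≤b = pg≡1 , pg≡r
    where
    pg≡r : p (suc g) ≡ r
    pg≡r with p (suc g) <? r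
    ... | no ≮r  = ≤-antisym (p≤r 1+g<m) (≮⇒≥ ≮r)
    ... | yes <r = ⊥-elim (probe 0 2 max 2≤4 contra)
      where
      contra : ¬ _
      contra E with Probe.side 0 2 max E
      ... | inj₁ k≡ = Probe.not-max 0 2 max E (key<max 2≤4) 1+g<m <r (Probe.Right.k-1+g 0 2 max E k≡)
      ... | inj₂ k≡ = Probe.not-max 0 2 max E (key<max 2≤4) g<m (≤-<-trans a≤b <r) k≡
    pg≡1 : p g ≡ 1
    pg≡1 with 1 <? p g
    ... | no 1≮  = ≤-antisym (≮⇒≥ 1≮) (p≥1 g<m)
    ... | yes 1< = ⊥-elim (probe 0 2 min 2≤4 contra)
      where
      contra : ¬ _
      contra E with Probe.side 0 2 min E
      ... | inj₁ k≡ = Probe.not-min 0 2 min E min<key 1+g<m (<-≤-trans 1< a≤b) (Probe.Right.k-1+g 0 2 min E k≡)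
      ... | inj₂ k≡ = Probe.not-min 0 2 min E min<key g<m 1< k≡

  module Tight (pg≡1 : p g ≡ 1) (pg+1≡r : p (suc g) ≡ r) where

    private
      pg<r : p g < r
      pg<r = subst (_< r) (sym pg≡1) 1<r

      1<pg+1 : 1 < p (suc g)
      1<pg+1 = subst (1 <_) (sym pg+1≡r) 1<r

      -- Only the letter `r` can play a maximum and `g` carries a smaller one, so `suc g` plays it
      -- and `g` stays.
      from-max : ∀ {z o} → o ≤ 4 → (∀ E → Embedding.k E g ≡ g → ⊥) → ⊥
      from-max {z} {o} o≤4 right = probe z o max o≤4 contra
        where
        contra : ¬ _
        contra E with Probe.side z o max E
        ... | inj₁ k≡ = right E k≡
        ... | inj₂ k≡ = Probe.not-max z o max E (key<max o≤4) g<m pg<r k≡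

      from-min : ∀ {z o} → o ≤ 4 → (∀ E → Embedding.k E g ≡ suc g → ⊥) → ⊥
      from-min {z} {o} o≤4 left = probe z o min o≤4 contra
        where
        contra : ¬ _
        contra E with Probe.side z o min E
        ... | inj₁ k≡ = Probe.not-min z o min E min<key 1+g<m 1<pg+1 (Probe.Right.k-1+g z o min E k≡)
        ... | inj₂ k≡ = left E k≡

    -- Around the gap the new word reads 1, r + 1, 0, r. The positions `h`, `g`, `suc g`,
    -- `suc (suc g)`, with letters 1, 1, r, r, are joined in Q, and `g` lands on place g, g + 1 or g
    -- + 2. In each case some 1 plays a larger value than some `r`.
    not-both-long : ∀ {h} → s ≤ h → suc h ≡ g → p h ≡ 1 → suc g < e → p (suc (suc g)) ≡ r → ⊥
    not-both-long {h} s≤h refl ph≡1 2+g≤e p≡r = forced (suc (suc m)) u record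
      { k          = skip c ∘ skip c
      ; bounded    = skip-bounded c ∘ skip-bounded c
      ; increasing = λ i<j _ → skip-mono-< c (skip-mono-< c i<j)
      ; order      = λ {i} {j} _ _ lt → subst₂ _<_ (sym (u-skip i)) (sym (u-skip j)) lt
      ; adjacent   = λ {i} _ J → trans (cong (skip c) (skip-suc c (J≢ J)))
          (skip-suc c (λ eq → J≢ J (cong suc (skip-fix eq))))
      } contra
      where
      inner u : ℕ → ℕ
      inner = ins (suc g) 0 p
      u     = ins (suc g) (suc r) inner
      u-skip : ∀ i → u (skip c (skip c i)) ≡ p i
      u-skip i = trans (ins-skip c inner (skip c i)) (ins-skip c p i)
      skip-fix : ∀ {i} → suc (skip c i) ≡ suc g → i ≡ g
      skip-fix {i} eq with <-≤-connex i c
      ... | inj₁ i<c = suc-injective (trans (cong suc (sym (skip-< i<c))) eq)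
      ... | inj₂ c≤i = contradiction (subst (_≤ g) (skip-≥ c≤i) (≤-reflexive (suc-injective eq)))
                         (<⇒≱ (m≤n⇒m≤1+n c≤i))
      g-fixed : skip c g ≡ g
      g-fixed = skip-< ≤-refl
      u-g : u g ≡ 1
      u-g = trans (cong u (sym (trans (cong (skip c) g-fixed) g-fixed)))
              (trans (u-skip g) pg≡1)
      u-1+g : u (1 + g) ≡ suc r
      u-1+g = ins-at c inner
      c-moved : skip c c ≡ suc c
      c-moved = skip-≥ ≤-refl
      u-2+g : u (2 + g) ≡ 0
      u-2+g = trans (cong u (sym c-moved)) (trans (ins-skip c inner c) (ins-at c p))
      u-3+g : u (3 + g) ≡ r
      u-3+g = trans (cong u (sym (trans (cong (skip c) c-moved) (skip-≥ (n≤1+n c)))))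
                (trans (u-skip c) pg+1≡r)
      2+g<m : 2 + g < m
      2+g<m = ≤-<-trans 2+g≤e e<m
      contra : ¬ _
      contra E = go
        where
        open Embedding E
        k-1+g : k (suc g) ≡ suc (k g)
        k-1+g = adjacent 1+g<m (inj₂ refl)
        k-2+g : k (suc (suc g)) ≡ suc (suc (k g))
        k-2+g = trans (adjacent 2+g<m (inj₁ (J₃ ≤-refl 2+g≤e))) (cong suc k-1+g)
        k-g : k g ≡ suc (k h)
        k-g = adjacent g<m (inj₁ (J₂ s≤h ≤-refl))
        k≥ : g ≤ k g
        k≥ = i≤ki E g<m
        k≤ : k g ≤ 2 + g
        k≤ = +-cancelʳ-≤ m (k g) (2 + g)
          (≤-trans (ki≤ E g<m) (≤-reflexive (cong (2 +_) (+-comm m g))))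
        clash : ∀ {i j a b} → i < m → j < m → p i < p j → u (k i) ≡ a → u (k j) ≡ b → b < a → ⊥
        clash i<m j<m lt refl refl b<a = <⇒≱ b<a (order i<m j<m lt)
        go : ⊥
        go with m≤n⇒m<n∨m≡n k≥
        ... | inj₂ g≡k = clash g<m 2+g<m (subst₂ _<_ (sym pg≡1) (sym p≡r) 1<r)
                (trans (cong u (sym g≡k)) u-g)
                (trans (cong u (trans k-2+g (cong (2 +_) (sym g≡k)))) u-2+g) ≤-refl
        ... | inj₁ g<k with m≤n⇒m<n∨m≡n g<k
        ...   | inj₂ 1+g≡k = clash g<m 1+g<m (subst₂ _<_ (sym pg≡1) (sym pg+1≡r) 1<r)
                (trans (cong u (sym 1+g≡k)) u-1+g)
                (trans (cong u (trans k-1+g (cong suc (sym 1+g≡k)))) u-2+g) (s≤s z≤n)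
        ...   | inj₁ 1+g<k = clash (<-trans (n<1+n h) g<m) 1+g<m (subst₂ _<_ (sym ph≡1) (sym pg+1≡r) 1<r)
                (trans (cong u (suc-injective (trans (sym k-g) k≡))) u-1+g)
                (trans (cong u (trans k-1+g (cong suc k≡))) u-3+g) ≤-refl
          where
          k≡ : k g ≡ 2 + g
          k≡ = ≤-antisym k≤ 1+g<k

    -- Patterns with at least three letters

    module ThreeLetters (2<r : 2 < r) where

      private
        0≤4 : 0 ≤ 4
        0≤4 = z≤n

        three≤ : ∀ {i} → r ≤ p i → 3 ≤ p i
        three≤ = ≤-trans 2<r

      module _ {z} (z<m : z < m) (pz≡2 : p z ≡ 2) where

        -- The inserted value 11 lies directly above the letter 2 at z, which is
        -- the lowest of its class.
        private
          from-11 : (∀ E → Embedding.k E g ≡ g → ⊥) → ⊥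
          from-11 right = probe z 0 11 0≤4 contra
            where
            contra : ¬ _
            contra E with Probe.side z 0 11 E
            ... | inj₁ k≡ = right E k≡
            ... | inj₂ k≡ = Probe.Left.below-x z 0 11 E k≡
                  (λ {i} _ p≤1 → ≤-trans (s≤s (key-≤ p {z} i 0≤4 p≤1)) (≤ᵇ⇒≤ 10 11 _)) pg≡1
                  z<m (subst (1 <_) (sym pz≡2) ≤-refl)
                  (≤-reflexive (cong suc (trans (key-at p 0) (cong (λ a → 5 * a + 0) pz≡2))))

        -- Position `suc i` plays the element of `i`, whose key is at least 15. As `suc g` plays 11
        -- with the letter `r`, the letter at `suc i` cannot be below `r`.
        σ₃-constant-step : ∀ {i} → suc g ≤ i → i < e → p i ≡ r → p (suc i) ≡ r
        σ₃-constant-step {i} g<i i<e pi≡r with p (suc i) ≟ r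
        ... | yes p≡r = p≡r
        ... | no  p≢r = ⊥-elim (from-11 λ E k≡ →
              let open Probe z 0 11 E
                  open Right k≡
              in
          <⇒≱ (≤-trans (≤ᵇ⇒≤ 12 15 _) (key-≥ p {z} i (three≤ (≤-reflexive (sym pi≡r)))))
            (subst₂ _≤_ (U-σ₃ g<i i<e) U-1+g
              (order (≤-<-trans i<e e<m) 1+g<m
                (subst (p (suc i) <_) (sym pg+1≡r) (≤∧≢⇒< (p≤r (≤-<-trans i<e e<m)) p≢r)))))

        -- Any other element strictly between the classes 1 and `r` has key at least 12, above the
        -- value 11 that plays `r`; `above-x` excludes this.
        middle-unique : ∀ {y} → y < m → 1 < p y → p y < r → y ≡ z
        middle-unique {y} y<m 1<py py<r with y ≟ z
        ... | yes y≡z = y≡z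
        ... | no  y≢z = ⊥-elim (from-11 λ E k≡ → Probe.Right.above-x z 0 11 E k≡
          (λ {i} _ r≤p → ≤-trans (≤ᵇ⇒≤ 12 15 _) (key-≥ p {z} i (three≤ r≤p))) pg+1≡r y<m py<r
          (≤-trans (+-monoˡ-≤ 2 (*-monoʳ-≤ 5 1<py)) (≤-reflexive (sym (key-off p 0 y≢z)))))

        -- Here 13 lies directly below the letter 2 at z, the highest of its class.
        σ₂-constant-step : r ≡ 3 → ∀ {i} → s ≤ i → i < g → p (suc i) ≡ 1 → p i ≡ 1
        σ₂-constant-step refl {i} s≤i i<g p≡1 with p i ≟ 1
        ... | yes pi≡1 = pi≡1
        ... | no  pi≢1 = ⊥-elim (probe z 4 13 ≤-refl contra)
          where
          contra : ¬ _
          contra E with Probe.side z 4 13 E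
          ... | inj₂ k≡ =
                let open Probe z 4 13 E
                    open Left k≡
                in
            <⇒≱ (≤-trans (s≤s (key-≤ p {z} (suc i) ≤-refl (≤-reflexive p≡1))) (≤ᵇ⇒≤ 10 13 _))
              (subst₂ _≤_ U-g (U-σ₂ s≤i i<g) (order g<m (<-trans i<g g<m)
                (subst (_< p i) (sym pg≡1) (≤∧≢⇒< (p≥1 (<-trans i<g g<m)) (pi≢1 ∘ sym)))))
          ... | inj₁ k≡ = Probe.Right.above-x z 4 13 E k≡
            (λ {i} _ r≤p → ≤-trans (≤ᵇ⇒≤ 14 15 _) (key-≥ p {z} i r≤p)) pg+1≡r z<m
            (subst (_< 3) (sym pz≡2) ≤-refl)
            (≤-reflexive (sym (trans (key-at p 4) (cong (λ a → 5 * a + 4) pz≡2))))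

      -- For larger `r` the letters 2 and 3 would both be strictly between 1 and `r`, against
      -- `middle-unique`.
      r≡3 : r ≡ 3
      r≡3 with r ≟ 3
      ... | yes r≡ = r≡
      ... | no  r≢ with attained {2} (s≤s z≤n) (<⇒≤ 2<r) | attained {3} (s≤s z≤n) 2<r
      ...   | z , z<m , pz≡2 | y , y<m , py≡3 = contradiction
        (trans (sym py≡3) (trans (cong p (middle-unique z<m pz≡2 y<m
          (subst (1 <_) (sym py≡3) (s≤s (s≤s z≤n)))
          (subst (_< r) (sym py≡3) (≤∧≢⇒< 2<r (r≢ ∘ sym))))) pz≡2)) λ ()

    -- Patterns with two letters

    module TwoLetters (r≡2 : r ≡ 2) where

      letter-1∨2 : ∀ {i} → i < m → p i ≡ 1 ⊎ p i ≡ 2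
      letter-1∨2 {i} i<m with p i | p≥1 i<m | subst (p i ≤_) r≡2 (p≤r i<m)
      ... | 1 | _ | _ = inj₁ refl
      ... | 2 | _ | _ = inj₂ refl
      ... | suc (suc (suc _)) | _ | s≤s (s≤s ())

      -- A maximum is inserted, and the 2 at `suc g` is made the lowest of its class, with key 10.
      -- Position `suc (suc g)` plays it, while `suc i` plays the 2 at `i`, with key 12. So `suc i`
      -- cannot carry 1.
      σ₃-constant-step : suc g < e → p (suc (suc g)) ≡ 2 →
                         ∀ {i} → suc g < i → i < e → p i ≡ 2 → p (suc i) ≡ 2
      σ₃-constant-step 2+g≤e p≡2 {i} g+1<i i<e pi≡2 with letter-1∨2 (≤-<-trans i<e e<m)
      ... | inj₂ q≡2 = q≡2
      ... | inj₁ q≡1 = ⊥-elim (from-max {suc g} {0} z≤n λ E k≡ →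
        let open Probe (suc g) 0 max E
            open Right k≡
        in
        <⇒≱ {10} {12} (≤ᵇ⇒≤ 11 12 _) (subst₂ _≤_
          (trans (U-σ₃ (<⇒≤ g+1<i) i<e) (trans (key-off p 0 (>⇒≢ g+1<i)) (cong (λ a → 5 * a + 2) pi≡2)))
          (trans (U-σ₃ ≤-refl 2+g≤e) (trans (key-at p 0) (cong (λ a → 5 * a + 0) (trans pg+1≡r r≡2))))
          (order (≤-<-trans i<e e<m) (≤-<-trans 2+g≤e e<m) (subst₂ _<_ (sym q≡1) (sym p≡2) ≤-refl))))

      -- A maximum is inserted, and the 2 at `suc g` is made the highest of its class, with key 14.
      -- The 1 at `suc (suc g)` plays it, so another 2 would need a value of at least 14. The
      -- maximum and the key 14 are taken, and all other keys are at most 12.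
      2-unique : suc g < e → p (suc (suc g)) ≡ 1 → ∀ {z} → z < m → p z ≡ 2 → z ≡ suc g
      2-unique 2+g≤e p≡1 {z} z<m pz≡2 with z ≟ suc g
      ... | yes z≡ = z≡
      ... | no  z≢ = ⊥-elim (from-max {suc g} {4} ≤-refl contra)
        where
        contra : ∀ E → Embedding.k E g ≡ g → ⊥
        contra E k≡ = go (k-unskip z<m λ kz≡ → z≢ (k-injective E z<m 1+g<m (trans kz≡ (sym k-1+g))))
          where
          open Probe (suc g) 4 max E
          open Right k≡
          14≤Uz : 14 ≤ U z
          14≤Uz = subst (_≤ U z)
            (trans (U-σ₃ ≤-refl 2+g≤e) (trans (key-at p 4) (cong (λ a → 5 * a + 4) (trans pg+1≡r r≡2))))
            (order (≤-<-trans 2+g≤e e<m) z<m (subst₂ _<_ (sym p≡1) (sym pz≡2) ≤-refl))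
          go : (∃ λ l → l < m × k z ≡ skip (suc g) l) → ⊥
          go (l , l<m , eq) with l ≟ suc g
          ... | yes refl = contradiction (trans (sym p≡1) (trans (cong p (sym z≡2+g)) pz≡2)) λ ()
            where
            z≡2+g : z ≡ suc (suc g)
            z≡2+g = k-injective E z<m (≤-<-trans 2+g≤e e<m)
              (trans eq (trans (skip-≥ ≤-refl) (sym (k-σ₃ (n≤1+n _) 2+g≤e))))
          ... | no l≢ = <⇒≱ {12} {14} (≤ᵇ⇒≤ 13 14 _) (≤-trans 14≤Uz
            (≤-trans (≤-reflexive (trans (U-skip eq) (key-off p 4 l≢)))
              (+-monoˡ-≤ 2 (*-monoʳ-≤ 5 (≤-trans (p≤r l<m) (≤-reflexive r≡2))))))

      -- Dually, a minimum is inserted and the 1 at `g` is the highest of its class, with key 9.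
      -- Position `h` plays it, whereas `i` plays the 1 at `suc i`, with key 7; so `i` cannot carry
      -- 2.
      σ₂-constant-step : ∀ {h} → s ≤ h → suc h ≡ g → p h ≡ 1 →
                         ∀ {i} → s ≤ i → i < h → p (suc i) ≡ 1 → p i ≡ 1
      σ₂-constant-step {h} s≤h refl ph≡1 {i} s≤i i<h q≡1 with letter-1∨2 (<-trans i<h (<-trans (n<1+n h) g<m))
      ... | inj₁ pi≡1 = pi≡1
      ... | inj₂ pi≡2 = ⊥-elim (from-min {g} {4} ≤-refl λ E k≡ →
        let open Probe g 4 min E
            open Left k≡
        in
        <⇒≱ {7} {9} (≤ᵇ⇒≤ 8 9 _) (subst₂ _≤_
          (trans (U-σ₂ s≤h ≤-refl) (trans (key-at p 4) (cong (λ a → 5 * a + 4) pg≡1)))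
          (trans (U-σ₂ s≤i (<-trans i<h (n<1+n h)))
            (trans (key-off p 4 (<⇒≢ (s≤s i<h))) (cong (λ a → 5 * a + 2) q≡1)))
          (order (<-trans (n<1+n h) g<m) (<-trans i<h (<-trans (n<1+n h) g<m))
            (subst₂ _<_ (sym ph≡1) (sym pi≡2) ≤-refl))))

      -- A minimum is inserted and the 1 at `g` is the lowest of its class, with key 5. The 2 at `h`
      -- plays it, so another 1 would need a value of at most 5, but the elements left over have
      -- keys of at least 7.
      1-unique : ∀ {h} → s ≤ h → suc h ≡ g → p h ≡ 2 → ∀ {z} → z < m → p z ≡ 1 → z ≡ g
      1-unique {h} s≤h refl ph≡2 {z} z<m pz≡1 with z ≟ g
      ... | yes z≡ = z≡
      ... | no  z≢ = ⊥-elim (from-min {g} {0} z≤n contra)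
        where
        h<m : h < m
        h<m = <-trans (n<1+n h) g<m
        contra : ∀ E → Embedding.k E g ≡ suc g → ⊥
        contra E k≡ = go (k-unskip z<m λ kz≡ → z≢ (k-injective E z<m g<m (trans kz≡ (sym k≡))))
          where
          open Probe g 0 min E
          open Left k≡
          Uz≤5 : U z ≤ 5
          Uz≤5 = subst (U z ≤_)
            (trans (U-σ₂ s≤h ≤-refl) (trans (key-at p 0) (cong (λ a → 5 * a + 0) pg≡1)))
            (order z<m h<m (subst₂ _<_ (sym pz≡1) (sym ph≡2) ≤-refl))
          go : (∃ λ l → l < m × k z ≡ skip (suc g) l) → ⊥
          go (l , l<m , eq) with l ≟ g
          ... | yes refl = contradiction (trans (sym ph≡2) (trans (cong p (sym z≡h)) pz≡1)) λ ()
            where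
            z≡h : z ≡ h
            z≡h = k-injective E z<m h<m
              (trans eq (trans (skip-< ≤-refl) (sym (k-σ₂ s≤h (n≤1+n h)))))
          ... | no l≢ = <⇒≱ {5} {7} (≤ᵇ⇒≤ 6 7 _) (≤-trans
            (≤-trans (+-monoˡ-≤ 2 (*-monoʳ-≤ 5 (p≥1 l<m)))
              (≤-reflexive (sym (trans (U-skip eq) (key-off p 0 l≢))))) Uz≤5)

      -- The letter just before `g` decides: a 1 there spreads over all of σ₂, a 2 makes the 1 at
      -- `g` unique.
      σ₂-shape : (∀ {i} → s ≤ i → i ≤ g → p i ≡ 1) ⊎
                 (s < g × (∀ {i} → i < m → p i ≡ 1 → i ≡ g))
      σ₂-shape with m≤n⇒m<n∨m≡n s≤g
      ... | inj₂ refl = inj₁ λ s≤i i≤g → trans (cong p (≤-antisym i≤g s≤i)) pg≡1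
      ... | inj₁ s<g with predecessor s<g
      ...   | h , 1+h≡g , s≤h with letter-1∨2 (<-trans (≤-reflexive 1+h≡g) g<m)
      ...     | inj₂ ph≡2 = inj₂ (s<g , 1-unique s≤h 1+h≡g ph≡2)
      ...     | inj₁ ph≡1 = inj₁ λ {i} s≤i i≤g → constant s≤i (m≤n⇒m<n∨m≡n i≤g)
        where
        constant : ∀ {i} → s ≤ i → i < g ⊎ i ≡ g → p i ≡ 1
        constant s≤i (inj₂ refl) = pg≡1
        constant s≤i (inj₁ i<g)  = descend (λ i → p i ≡ 1)
          (s≤s⁻¹ (subst (_ <_) (sym 1+h≡g) i<g)) ph≡1
          λ i≤l l<h → σ₂-constant-step s≤h 1+h≡g ph≡1 (≤-trans s≤i i≤l) l<h

      -- Here the letter just after `suc g` decides.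
      σ₃-shape : (∀ {i} → suc g ≤ i → i ≤ e → p i ≡ 2) ⊎
                 (suc g < e × (∀ {i} → i < m → p i ≡ 2 → i ≡ suc g))
      σ₃-shape with m≤n⇒m<n∨m≡n g<e
      ... | inj₂ refl = inj₁ λ g<i i≤e → trans (cong p (≤-antisym i≤e g<i)) (trans pg+1≡r r≡2)
      ... | inj₁ 1+g<e with letter-1∨2 (≤-<-trans 1+g<e e<m)
      ...   | inj₁ p≡1 = inj₂ (1+g<e , 2-unique 1+g<e p≡1)
      ...   | inj₂ p≡2 = inj₁ λ g<i i≤e → constant i≤e (m≤n⇒m<n∨m≡n g<i)
        where
        constant : ∀ {i} → i ≤ e → suc g < i ⊎ suc g ≡ i → p i ≡ 2
        constant i≤e (inj₂ refl) = trans pg+1≡r r≡2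
        constant i≤e (inj₁ 1+g<i) = ascend (λ i → p i ≡ 2) 1+g<i p≡2
          λ 1+g<l l<i → σ₃-constant-step 1+g<e p≡2 1+g<l (<-≤-trans l<i i≤e)

-- Sufficiency

-- Stated for an arbitrary total transitive relation so as to give both a least and a greatest
-- value.
extremum : ∀ {R : ℕ → ℕ → Set} → Total R → Transitive R → (f : ℕ → ℕ) → ∀ {a b} → a < b →
           ∃ λ t → a ≤ t × t < b × (∀ {q} → a ≤ q → q < b → R (f t) (f q))
extremum {R} total R-trans f {a} = go ∘ ≤⇒≤′
  where
  R-refl : ∀ x → R x x
  R-refl x = [ (λ xx → xx) , (λ xx → xx) ]′ (total x x)
  split : ∀ {b q} → q < suc b → (q < b → R (f b) (f q)) → R (f b) (f q)
  split {b} {q} q≤b below with m≤n⇒m<n∨m≡n (s≤s⁻¹ q≤b)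
  ... | inj₁ q<b  = below q<b
  ... | inj₂ refl = R-refl (f q)
  go : ∀ {b} → suc a ≤′ b → ∃ λ t → a ≤ t × t < b × (∀ {q} → a ≤ q → q < b → R (f t) (f q))
  go ≤′-refl = a , ≤-refl , ≤-refl , λ a≤q q≤a → subst (R (f a) ∘ f) (≤-antisym a≤q (s≤s⁻¹ q≤a)) (R-refl (f a))
  go (≤′-step {b} a<b) with go a<b
  ... | t , a≤t , t<b , best with total (f t) (f b)
  ...   | inj₂ bt = b , <⇒≤ (≤′⇒≤ a<b) , ≤-refl ,
          λ a≤q q≤b → split q≤b λ q<b → R-trans bt (best a≤q q<b)
  ...   | inj₁ tb = t , a≤t , m≤n⇒m≤1+n t<b , λ a≤q q≤b → best′ a≤q (m≤n⇒m<n∨m≡n (s≤s⁻¹ q≤b))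
          where
          best′ : ∀ {q} → a ≤ q → q < b ⊎ q ≡ b → R (f t) (f q)
          best′ a≤q (inj₁ q<b)  = best a≤q q<b
          best′ a≤q (inj₂ refl) = tb

module _ {L H : ℕ → Set} where

  -- The first step from low to high leaves only low places before it, which is what a long σ₂
  -- needs.
  first-crossing : ∀ {a b} → a < b → L a → H b → (∀ {q} → a < q → q < b → L q ⊎ H q) →
                   ∃ λ t → a ≤ t × t < b × (∀ {q} → a ≤ q → q ≤ t → L q) × H (suc t)
  first-crossing {a} {b} a<b La Hb = go (b ∸ suc a) (m∸n+n≡m a<b) La
    where
    go : ∀ d {a} → d + suc a ≡ b → L a → (∀ {q} → a < q → q < b → L q ⊎ H q) →
         ∃ λ t → a ≤ t × t < b × (∀ {q} → a ≤ q → q ≤ t → L q) × H (suc t)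
    go zero {a} refl La _ =
      a , ≤-refl , ≤-refl , (λ a≤q q≤a → subst L (≤-antisym a≤q q≤a) La) , Hb
    go (suc d) {a} refl La split
      with split ≤-refl (s≤s (m≤n+m (suc a) d)) | go d (+-suc d (suc a))
    ... | inj₂ H1+a | _ =
          a , ≤-refl , m≤n+m (suc a) (suc d) , (λ a≤q q≤a → subst L (≤-antisym a≤q q≤a) La) , H1+a
    ... | inj₁ L1+a | rec with rec L1+a (split ∘ <-trans ≤-refl)
    ...   | t , a<t , t<b , low , high = t , <⇒≤ a<t , t<b , low′ , high
            where
            low′ : ∀ {q} → a ≤ q → q ≤ t → L q
            low′ a≤q q≤t with m≤n⇒m<n∨m≡n a≤q
            ... | inj₁ a<q  = low a<q q≤t
            ... | inj₂ refl = La

  -- The last step from low to high leaves only high places after it, which is what a long σ₃ needs.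
  last-crossing : ∀ {a b} → a < b → L a → H b → (∀ {q} → a < q → q < b → L q ⊎ H q) →
                  ∃ λ t → a ≤ t × t < b × L t × (∀ {q} → t < q → q ≤ b → H q)
  last-crossing {a} a<b La = go (≤⇒≤′ a<b)
    where
    go : ∀ {b} → suc a ≤′ b → H b → (∀ {q} → a < q → q < b → L q ⊎ H q) →
         ∃ λ t → a ≤ t × t < b × L t × (∀ {q} → t < q → q ≤ b → H q)
    go ≤′-refl Hb _ = a , ≤-refl , ≤-refl , La , λ a<q q≤b → subst H (≤-antisym a<q q≤b) Hb
    go (≤′-step {b} a<b) H1+b split with split (≤′⇒≤ a<b) ≤-refl
    ... | inj₁ Lb = b , <⇒≤ (≤′⇒≤ a<b) , ≤-refl , Lb , λ b<q q≤b → subst H (≤-antisym b<q q≤b) H1+b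
    ... | inj₂ Hb with go a<b Hb (λ a<q q<b → split a<q (m≤n⇒m≤1+n q<b))
    ...   | t , a≤t , t<b , Lt , high = t , a≤t , m≤n⇒m≤1+n t<b , Lt , high′
            where
            high′ : ∀ {q} → t < q → q ≤ suc b → H q
            high′ t<q q≤ with m≤n⇒m<n∨m≡n q≤
            ... | inj₁ q<    = high t<q (s≤s⁻¹ q<)
            ... | inj₂ refl  = H1+b

-- Turning an occurrence of P into one of Q

module If
  {m g s e : ℕ} {p : ℕ → ℕ} {J : ℕ → Set}
  (s≤g : s ≤ g) (g<e : g < e) (e<m : e < m)
  (J₂ : ∀ {i} → s ≤ i → i < g → J i)
  (J₃ : ∀ {i} → suc g ≤ i → i < e → J i)
  (¬Js : ∀ {i} → suc i ≡ s → ¬ J i) (¬Je : ¬ J e)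
  {n : ℕ} {v : ℕ → ℕ}
  (v-injective : ∀ {i j} → i < n → j < n → v i ≡ v j → i ≡ j)
  (E : Embedding m p J n (λ a b → v a < v b))
  where

  open Embedding E

  private
    g<m : g < m
    g<m = <-trans g<e e<m

    1+g<m : suc g < m
    1+g<m = ≤-<-trans g<e e<m

  k-mono-≤ : ∀ {i j} → i ≤ j → j < m → k i ≤ k j
  k-mono-≤ i≤j j<m with m≤n⇒m<n∨m≡n i≤j
  ... | inj₁ i<j  = <⇒≤ (increasing i<j j<m)
  ... | inj₂ refl = ≤-refl

  k-gap : k g < k (suc g)
  k-gap = increasing ≤-refl 1+g<m

  -- A joined block occupies an interval of places without holes.
  hit : ∀ {a b q} → a ≤ b → (∀ {l} → a ≤ l → l < b → J l) → b < m → k a ≤ q → q ≤ k b →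
        ∃ λ i → a ≤ i × i ≤ b × q ≡ k i
  hit {a} {q = q} a≤b = go (≤⇒≤′ a≤b)
    where
    go : ∀ {b} → a ≤′ b → (∀ {l} → a ≤ l → l < b → J l) → b < m → k a ≤ q → q ≤ k b →
         ∃ λ i → a ≤ i × i ≤ b × q ≡ k i
    go ≤′-refl           _   _   ka≤q q≤ka = a , ≤-refl , ≤-refl , ≤-antisym q≤ka ka≤q
    go (≤′-step {b} a≤b) J-l b<m ka≤q q≤k with m≤n⇒m<n∨m≡n q≤k
    ... | inj₂ q≡k = suc b , m≤n⇒m≤1+n (≤′⇒≤ a≤b) , ≤-refl , q≡k
    ... | inj₁ q<k with go a≤b (λ a≤l l<b → J-l a≤l (m≤n⇒m≤1+n l<b)) (<-trans (n<1+n b) b<m) ka≤q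
                         (s≤s⁻¹ (subst (q <_) (adjacent b<m (J-l (≤′⇒≤ a≤b) ≤-refl)) q<k))
    ...   | i , a≤i , i≤b , q≡ = i , a≤i , m≤n⇒m≤1+n i≤b , q≡

  -- σ₂ is slid to the right until it ends at t, and σ₃ to the left until it
  -- starts at t + 1; both are described by i ↦ i + t − g.
  module Slide {t : ℕ} (kg≤t : k g ≤ t) (t<k : t < k (suc g)) where

    k′ : ℕ → ℕ
    k′ i with i <? s
    ... | yes _ = k i
    ... | no  _ with i ≤? e
    ...   | yes _ = i + t ∸ g
    ...   | no  _ = k i

    k′-before : ∀ {i} → i < s → k′ i ≡ k i
    k′-before {i} i<s with i <? s
    ... | yes _   = refl
    ... | no  i≮s = contradiction i<s i≮s

    k′-after : ∀ {i} → e < i → k′ i ≡ k i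
    k′-after {i} e<i with i <? s
    ... | yes _   = refl
    ... | no  _ with i ≤? e
    ...   | yes i≤e = contradiction i≤e (<⇒≱ e<i)
    ...   | no  _   = refl

    k′-within : ∀ {i} → s ≤ i → i ≤ e → k′ i ≡ i + t ∸ g
    k′-within {i} s≤i i≤e with i <? s
    ... | yes i<s = contradiction s≤i (<⇒≱ i<s)
    ... | no  _ with i ≤? e
    ...   | yes _   = refl
    ...   | no  i≰e = contradiction i≤e i≰e

    k-g+ : ∀ {i} → s ≤ i → i ≤ g → k i + g ≤ i + t
    k-g+ {i} s≤i i≤g = ≤-trans (≤-reflexive (trans (run E J₂ g<m s≤i i≤g ≤-refl) (+-comm (k g) i)))
      (+-monoʳ-≤ i kg≤t)

    -- Makes the truncated subtraction `i + t ∸ g` exact on the moved block.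
    g≤i+t : ∀ {i} → s ≤ i → g ≤ i + t
    g≤i+t {i} s≤i = ≤-trans (m≤n+m g (k s)) (≤-trans (k-g+ ≤-refl s≤g) (+-monoˡ-≤ t s≤i))

    k≤k′ : ∀ {i} → s ≤ i → i ≤ g → k i ≤ k′ i
    k≤k′ {i} s≤i i≤g = subst (k i ≤_) (sym (k′-within s≤i (≤-trans i≤g (<⇒≤ g<e))))
      (m+n≤o⇒m≤o∸n (k i) (k-g+ s≤i i≤g))

    k′≤k : ∀ {i} → g < i → i ≤ e → k′ i ≤ k i
    k′≤k {i} g<i i≤e = subst (_≤ k i) (sym (k′-within (≤-trans s≤g (<⇒≤ g<i)) i≤e))
      (m≤n+o⇒m∸n≤o (i + t) g (s≤s⁻¹ (begin
        suc (i + t)       ≡⟨ sym (+-suc i t) ⟩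
        i + suc t         ≤⟨ +-monoʳ-≤ i t<k ⟩
        i + k (suc g)     ≡⟨ +-comm i (k (suc g)) ⟩
        k (suc g) + i     ≡⟨ run E J₃ e<m ≤-refl g<i i≤e ⟩
        k i + suc g       ≡⟨ +-comm (k i) (suc g) ⟩
        suc (g + k i)     ∎)))
      where open ≤-Reasoning

    k′-g : k′ g ≡ t
    k′-g = trans (k′-within s≤g (<⇒≤ g<e)) (m+n∸m≡n g t)

    k′-suc : ∀ {i} → s ≤ i → i < e → k′ (suc i) ≡ suc (k′ i)
    k′-suc {i} s≤i i<e = trans (k′-within (m≤n⇒m≤1+n s≤i) i<e)
      (trans (+-∸-assoc 1 (g≤i+t s≤i)) (cong suc (sym (k′-within s≤i (<⇒≤ i<e)))))

    k′-1+g : k′ (suc g) ≡ suc t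
    k′-1+g = trans (k′-suc s≤g g<e) (cong suc k′-g)

    data Zone (i : ℕ) : Set where
      before : i < s → Zone i
      inside : s ≤ i → i < e → Zone i
      end    : i ≡ e → Zone i
      after  : e < i → Zone i

    zone : ∀ i → Zone i
    zone i with <-≤-connex i s | <-cmp i e
    ... | inj₁ i<s | _           = before i<s
    ... | inj₂ s≤i | tri< i<e _ _ = inside s≤i i<e
    ... | inj₂ _   | tri≈ _ i≡e _ = end i≡e
    ... | inj₂ _   | tri> _ _ e<i = after e<i

    k′-step : ∀ {i} → suc i < m → k′ i < k′ (suc i)
    k′-step {i} i<m with zone i
    ... | inside s≤i i<e = ≤-reflexive (sym (k′-suc s≤i i<e))
    ... | end refl = ≤-<-trans (k′≤k g<e ≤-refl)
          (subst (k e <_) (sym (k′-after ≤-refl)) (increasing ≤-refl i<m))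
    ... | after e<i = subst₂ _<_ (sym (k′-after e<i)) (sym (k′-after (m≤n⇒m≤1+n e<i)))
          (increasing ≤-refl i<m)
    ... | before i<s with m≤n⇒m<n∨m≡n i<s
    ...   | inj₁ 1+i<s = subst₂ _<_ (sym (k′-before i<s)) (sym (k′-before 1+i<s)) (increasing ≤-refl i<m)
    ...   | inj₂ refl  = subst (_< k′ (suc i)) (sym (k′-before i<s))
            (<-≤-trans (increasing ≤-refl i<m) (k≤k′ ≤-refl s≤g))

    k′-increasing : ∀ {i j} → i < j → j < m → k′ i < k′ j
    k′-increasing {i} i<j = go (≤⇒≤′ i<j)
      where
      go : ∀ {j} → suc i ≤′ j → j < m → k′ i < k′ j
      go ≤′-refl           j<m = k′-step j<m
      go (≤′-step {j} i<j) j<m = <-trans (go i<j (<-trans (n<1+n j) j<m)) (k′-step j<m)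

    k′-bounded : ∀ {i} → i < m → k′ i < n
    k′-bounded {i} i<m with <-≤-connex g i | <-≤-connex e i
    ... | inj₂ i≤g | _ = ≤-<-trans k′i≤t (<-trans t<k (bounded 1+g<m))
      where
      k′i≤t : k′ i ≤ t
      k′i≤t with m≤n⇒m<n∨m≡n i≤g
      ... | inj₁ i<g  = <⇒≤ (subst (k′ i <_) k′-g (k′-increasing i<g g<m))
      ... | inj₂ refl = ≤-reflexive k′-g
    ... | inj₁ g<i | inj₂ i≤e = ≤-<-trans (k′≤k g<i i≤e) (bounded i<m)
    ... | inj₁ _   | inj₁ e<i = subst (_< n) (sym (k′-after e<i)) (bounded i<m)

    -- By `¬Js` and `¬Je` the moved block is bordered by dashes, so no joined pair has only one of
    -- its two positions in the block.
    k′-adjacent : ∀ {i} → suc i < m → J i ⊎ i ≡ g → k′ (suc i) ≡ suc (k′ i)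
    k′-adjacent i<m (inj₂ refl) = k′-suc s≤g g<e
    k′-adjacent {i} i<m (inj₁ Ji) with zone i
    ... | inside s≤i i<e = k′-suc s≤i i<e
    ... | end refl = contradiction Ji ¬Je
    ... | after e<i = trans (k′-after (m≤n⇒m≤1+n e<i))
          (trans (adjacent i<m Ji) (cong suc (sym (k′-after e<i))))
    ... | before i<s with m≤n⇒m<n∨m≡n i<s
    ...   | inj₁ 1+i<s = trans (k′-before 1+i<s) (trans (adjacent i<m Ji) (cong suc (sym (k′-before i<s))))
    ...   | inj₂ 1+i≡s = contradiction Ji (¬Js 1+i≡s)

    slid : (∀ {i j} → i < m → j < m → p i < p j → v (k′ i) < v (k′ j)) →
           Embedding m p (λ i → J i ⊎ i ≡ g) n (λ a b → v a < v b)
    slid ord = record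
      { k = k′ ; bounded = k′-bounded ; increasing = k′-increasing ; order = ord ; adjacent = k′-adjacent }

    -- After sliding, a position of σ₂ is on a place that σ₂ already used or strictly inside the
    -- gap; only gap elements acquire a new role.
    data Located₂ (q : ℕ) : Set where
      old : ∀ {j} → s ≤ j → j ≤ g → q ≡ k j → Located₂ q
      new : k g < q → q ≤ t → Located₂ q

    locate₂ : ∀ {i} → s ≤ i → i ≤ g → Located₂ (k′ i)
    locate₂ {i} s≤i i≤g with <-≤-connex (k g) (k′ i)
    ... | inj₁ kg< = new kg< (subst (k′ i ≤_) k′-g k′i≤)
      where
      k′i≤ : k′ i ≤ k′ g
      k′i≤ with m≤n⇒m<n∨m≡n i≤g
      ... | inj₁ i<g  = <⇒≤ (k′-increasing i<g g<m)
      ... | inj₂ refl = ≤-refl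
    ... | inj₂ ≤kg with hit s≤g J₂ g<m (≤-trans (k-mono-≤ s≤i (≤-<-trans i≤g g<m)) (k≤k′ s≤i i≤g)) ≤kg
    ...   | j , s≤j , j≤g , eq = old s≤j j≤g eq

    data Located₃ (q : ℕ) : Set where
      old : ∀ {j} → g < j → j ≤ e → q ≡ k j → Located₃ q
      new : t < q → q < k (suc g) → Located₃ q

    locate₃ : ∀ {i} → g < i → i ≤ e → Located₃ (k′ i)
    locate₃ {i} g<i i≤e with <-≤-connex (k′ i) (k (suc g))
    ... | inj₁ <k = new (subst (_< k′ i) k′-g (k′-increasing g<i (≤-<-trans i≤e e<m))) <k
    ... | inj₂ k≤ with hit g<e J₃ e<m k≤ (≤-trans (k′≤k g<i i≤e) (k-mono-≤ i≤e e<m))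
    ...   | j , g<j , j≤e , eq = old g<j j≤e eq

    data Located (q : ℕ) : Set where
      old : ∀ {j} → j < m → q ≡ k j → Located q
      new : k g ≤ q → q < k (suc g) → Located q

    data Part (i : ℕ) : Set where
      outside : k′ i ≡ k i → Part i
      in-σ₂   : s ≤ i → i ≤ g → Part i
      in-σ₃   : g < i → i ≤ e → Part i

    part : ∀ i → Part i
    part i with <-≤-connex i s | <-≤-connex g i | <-≤-connex e i
    ... | inj₁ i<s | _        | _        = outside (k′-before i<s)
    ... | inj₂ s≤i | inj₂ i≤g | _        = in-σ₂ s≤i i≤g
    ... | inj₂ _   | inj₁ g<i | inj₂ i≤e = in-σ₃ g<i i≤e
    ... | inj₂ _   | inj₁ _   | inj₁ e<i = outside (k′-after e<i)

    locate : ∀ {i} → i < m → Located (k′ i)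
    locate {i} i<m with part i
    ... | outside eq = old i<m eq
    ... | in-σ₂ s≤i i≤g with locate₂ s≤i i≤g
    ...   | old _ j≤g eq  = old (≤-<-trans j≤g g<m) eq
    ...   | new kg< ≤t    = new (<⇒≤ kg<) (≤-<-trans ≤t t<k)
    locate {i} i<m | in-σ₃ g<i i≤e with locate₃ g<i i≤e
    ...   | old _ j≤e eq  = old (≤-<-trans j≤e e<m) eq
    ...   | new t< <k     = new (≤-trans kg≤t (<⇒≤ t<)) <k

    k′-injective : ∀ {i j} → i < m → j < m → v (k′ i) ≡ v (k′ j) → i ≡ j
    k′-injective {i} {j} i<m j<m eq with <-cmp i j
    ... | tri≈ _ i≡j _ = i≡j
    ... | tri< i<j _ _ = contradiction (v-injective (k′-bounded i<m) (k′-bounded j<m) eq)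
                           (<⇒≢ (k′-increasing i<j j<m))
    ... | tri> _ _ j<i = contradiction (v-injective (k′-bounded j<m) (k′-bounded i<m) (sym eq))
                           (<⇒≢ (k′-increasing j<i i<m))

  Result : Set
  Result = Embedding m p (λ i → J i ⊎ i ≡ g) n (λ a b → v a < v b)

  -- The letter `x` is compatible with the place `q`: 1 goes with low places, `r` with high ones,
  -- and a middle 2 separates the two.
  Class : ℕ → (L H : ℕ → Set) → ℕ → ℕ → Set
  Class r L H x q = (x ≡ 1 × L q) ⊎ (x ≡ r × H q) ⊎
                    (x ≡ 2 × (∀ {a} → L a → v a < v q) × (∀ {a} → H a → v q < v a))

  -- The order of values survives any slide that keeps σ₂ on low and σ₃ on high places, because all
  -- low values are below all high ones.
  module Threshold {r : ℕ} (1<r : 1 < r) {L H : ℕ → Set}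
    (L<H : ∀ {a b} → L a → H b → v a < v b)
    (class : ∀ {i} → i < m → Class r L H (p i) (k i))
    (between : ∀ {q} → k g < q → q < k (suc g) → L q ⊎ H q)
    (L-σ₂ : ∀ {i} → s ≤ i → i ≤ g → p i ≡ 1 × L (k i))
    (H-σ₃ : ∀ {i} → g < i → i ≤ e → p i ≡ r × H (k i))
    where

    private
      module _ {t} (kg≤t : k g ≤ t) (t<k : t < k (suc g)) where
        open Slide kg≤t t<k

        assemble : (∀ {i} → s ≤ i → i ≤ g → L (k′ i)) → (∀ {i} → g < i → i ≤ e → H (k′ i)) → Result
        assemble low high = slid λ i<m j<m → ordered (class′ i<m) (class′ j<m)
          where
          class′ : ∀ {i} → i < m → Class r L H (p i) (k′ i)
          class′ {i} i<m with part i
          ... | outside eq    = subst (Class r L H (p i)) (sym eq) (class i<m)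
          ... | in-σ₂ s≤i i≤g = inj₁ (proj₁ (L-σ₂ s≤i i≤g) , low s≤i i≤g)
          ... | in-σ₃ g<i i≤e = inj₂ (inj₁ (proj₁ (H-σ₃ g<i i≤e) , high g<i i≤e))
          ordered : ∀ {x y a b} → Class r L H x a → Class r L H y b → x < y → v a < v b
          ordered (inj₁ (_ , La)) (inj₂ (inj₁ (_ , Hb))) _ = L<H La Hb
          ordered (inj₁ (_ , La)) (inj₂ (inj₂ (_ , above , _))) _ = above La
          ordered (inj₂ (inj₂ (_ , _ , below))) (inj₂ (inj₁ (_ , Hb))) _ = below Hb
          ordered (inj₁ (refl , _)) (inj₁ (refl , _)) 1<1 = contradiction 1<1 (<-irrefl refl)
          ordered (inj₂ (inj₁ (refl , _))) (inj₁ (refl , _)) r<1 = contradiction r<1 (<⇒≯ 1<r)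
          ordered (inj₂ (inj₁ (refl , _))) (inj₂ (inj₁ (refl , _))) r<r = contradiction r<r (<-irrefl refl)
          ordered (inj₂ (inj₁ (refl , _))) (inj₂ (inj₂ (refl , _))) r<2 = contradiction r<2 (≤⇒≯ 1<r)
          ordered (inj₂ (inj₂ (refl , _))) (inj₁ (refl , _)) 2<1 = contradiction 2<1 (≤⇒≯ (s≤s z≤n))
          ordered (inj₂ (inj₂ (refl , _))) (inj₂ (inj₂ (refl , _))) 2<2 = contradiction 2<2 (<-irrefl refl)

      L-g = proj₂ (L-σ₂ s≤g ≤-refl)
      H-1+g = proj₂ (H-σ₃ ≤-refl g<e)

    -- At the first crossing, σ₂ slides over low places only, and the single letter of σ₃ lands on
    -- the high place just after them.
    σ₃-single : e ≡ suc g → Result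
    σ₃-single e≡ with first-crossing {L} {H} k-gap L-g H-1+g between
    ... | t , kg≤t , t<k , low , high = assemble kg≤t t<k low′ high′
      where
      open Slide kg≤t t<k
      low′ : ∀ {i} → s ≤ i → i ≤ g → L (k′ i)
      low′ s≤i i≤g with locate₂ s≤i i≤g
      ... | old s≤j j≤g eq = subst L (sym eq) (proj₂ (L-σ₂ s≤j j≤g))
      ... | new kg< ≤t     = low (<⇒≤ kg<) ≤t
      high′ : ∀ {i} → g < i → i ≤ e → H (k′ i)
      high′ {i} g<i i≤e with ≤-antisym (subst (i ≤_) e≡ i≤e) g<i
      ... | refl = subst H (sym k′-1+g) high

    -- At the last crossing, σ₃ slides back over high places only, and the single letter of σ₂ lands
    -- on the low place just before them.
    σ₂-single : s ≡ g → Result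
    σ₂-single s≡g with last-crossing {L} {H} k-gap L-g H-1+g between
    ... | t , kg≤t , t<k , low , high = assemble kg≤t t<k low′ high′
      where
      open Slide kg≤t t<k
      high′ : ∀ {i} → g < i → i ≤ e → H (k′ i)
      high′ g<i i≤e with locate₃ g<i i≤e
      ... | old g<j j≤e eq = subst H (sym eq) (proj₂ (H-σ₃ g<j j≤e))
      ... | new t< <k      = high t< (<⇒≤ <k)
      low′ : ∀ {i} → s ≤ i → i ≤ g → L (k′ i)
      low′ {i} s≤i i≤g with ≤-antisym i≤g (subst (_≤ i) s≡g s≤i)
      ... | refl = subst L (sym k′-g) low

  two-letters : (∀ {i} → i < m → p i ≡ 1 ⊎ p i ≡ 2) →
                (∀ {i} → s ≤ i → i ≤ g → p i ≡ 1) → (∀ {i} → g < i → i ≤ e → p i ≡ 2) →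
                s ≡ g ⊎ e ≡ suc g → Result
  two-letters letters σ₂≡1 σ₃≡2 = [ σ₂-single , σ₃-single ]′
    where
    L H : ℕ → Set
    -- The threshold is the least value playing 2. This makes every place low or high, decidably,
    -- with the 1's low and the 2's high.
    H q = ∃ λ l → l < m × (p l ≡ 2 × v (k l) ≤ v q)
    L q = ¬ H q
    L-k : ∀ {i} → i < m → p i ≡ 1 → L (k i)
    L-k i<m p≡1 (l , l<m , p≡2 , le) = <⇒≱ (order i<m l<m (subst₂ _<_ (sym p≡1) (sym p≡2) ≤-refl)) le
    H-k : ∀ {i} → i < m → p i ≡ 2 → H (k i)
    H-k {i} i<m p≡2 = i , i<m , p≡2 , ≤-refl
    split : ∀ q → L q ⊎ H q
    split q with anyUpTo? (λ l → (p l ≟ 2) ×-dec (v (k l) ≤? v q)) m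
    ... | yes high = inj₂ high
    ... | no  low  = inj₁ low
    L<H : ∀ {a b} → L a → H b → v a < v b
    L<H La (l , l<m , p≡2 , le) = <-≤-trans (≰⇒> λ le′ → La (l , l<m , p≡2 , le′)) le
    class : ∀ {i} → i < m → Class 2 L H (p i) (k i)
    class i<m = [ (λ p≡1 → inj₁ (p≡1 , L-k i<m p≡1)) ,
      (λ p≡2 → inj₂ (inj₁ (p≡2 , H-k i<m p≡2))) ]′ (letters i<m)
    L-σ₂ : ∀ {i} → s ≤ i → i ≤ g → p i ≡ 1 × L (k i)
    L-σ₂ s≤i i≤g = let p≡1 = σ₂≡1 s≤i i≤g in p≡1 , L-k (≤-<-trans i≤g g<m) p≡1
    H-σ₃ : ∀ {i} → g < i → i ≤ e → p i ≡ 2 × H (k i)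
    H-σ₃ g<i i≤e = let p≡2 = σ₃≡2 g<i i≤e in p≡2 , H-k (≤-<-trans i≤e e<m) p≡2
    open Threshold {2} ≤-refl {L} {H} L<H class (λ {q} _ _ → split q) L-σ₂ H-σ₃

  -- The value of the only 2 is the threshold.
  three-letters : (∀ {i} → i < m → p i ≡ 1 ⊎ p i ≡ 2 ⊎ p i ≡ 3) →
                  ∀ {z} → z < m → p z ≡ 2 → (∀ {i} → i < m → p i ≡ 2 → i ≡ z) →
                  (∀ {i} → s ≤ i → i ≤ g → p i ≡ 1) → (∀ {i} → g < i → i ≤ e → p i ≡ 3) →
                  s ≡ g ⊎ e ≡ suc g → Result
  three-letters letters {z} z<m pz≡2 unique σ₂≡1 σ₃≡3 = [ σ₂-single , σ₃-single ]′
    where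
    L H : ℕ → Set
    L q = v q < v (k z)
    H q = v (k z) < v q
    L-k : ∀ {i} → i < m → p i ≡ 1 → L (k i)
    L-k i<m p≡1 = order i<m z<m (subst₂ _<_ (sym p≡1) (sym pz≡2) ≤-refl)
    H-k : ∀ {i} → i < m → p i ≡ 3 → H (k i)
    H-k i<m p≡3 = order z<m i<m (subst₂ _<_ (sym pz≡2) (sym p≡3) ≤-refl)
    split : ∀ {q} → k g < q → q < k (suc g) → L q ⊎ H q
    split {q} kg<q q<k with <-cmp (v q) (v (k z))
    ... | tri< lt _ _ = inj₁ lt
    ... | tri> _ _ gt = inj₂ gt
    -- A gap element with the threshold value would sit at `k z`, but no place strictly inside the
    -- gap is used by the occurrence.
    ... | tri≈ _ eq _ with v-injective (<-trans q<k (bounded 1+g<m)) (bounded z<m) eq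
    ...   | refl with <-≤-connex g z
    ...     | inj₁ g<z = contradiction (k-mono-≤ g<z z<m) (<⇒≱ q<k)
    ...     | inj₂ z≤g = contradiction (k-mono-≤ z≤g g<m) (<⇒≱ kg<q)
    middle : ∀ {i} → i ≡ z → (∀ {a} → L a → v a < v (k i)) × (∀ {a} → H a → v (k i) < v a)
    middle refl = (λ La → La) , (λ Ha → Ha)
    class : ∀ {i} → i < m → Class 3 L H (p i) (k i)
    class i<m = [ (λ p≡1 → inj₁ (p≡1 , L-k i<m p≡1)) ,
      [ (λ p≡2 → inj₂ (inj₂ (p≡2 , middle (unique i<m p≡2)))) ,
        (λ p≡3 → inj₂ (inj₁ (p≡3 , H-k i<m p≡3))) ]′ ]′ (letters i<m)
    L-σ₂ : ∀ {i} → s ≤ i → i ≤ g → p i ≡ 1 × L (k i)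
    L-σ₂ s≤i i≤g = let p≡1 = σ₂≡1 s≤i i≤g in p≡1 , L-k (≤-<-trans i≤g g<m) p≡1
    H-σ₃ : ∀ {i} → g < i → i ≤ e → p i ≡ 3 × H (k i)
    H-σ₃ g<i i≤e = let p≡3 = σ₃≡3 g<i i≤e in p≡3 , H-k (≤-<-trans i≤e e<m) p≡3
    open Threshold {3} (s≤s (s≤s z≤n)) {L} {H} <-trans class split L-σ₂ H-σ₃

  -- σ₂ is slid until `g` sits on the least value of the gap, `k g` included. This value is at most
  -- that of every old or new place, and `g` alone carries 1; injectivity makes the inequalities
  -- strict.
  unique-1 : (∀ {i} → i < m → p i ≡ 1 ⊎ p i ≡ 2) → p g ≡ 1 → (∀ {i} → i < m → p i ≡ 1 → i ≡ g) → Result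
  unique-1 letters pg≡1 unique with extremum ≤-total ≤-trans v k-gap
  ... | t , kg≤t , t<k , best = slid ord
    where
    open Slide kg≤t t<k
    lowest : ∀ {j} → j < m → v t ≤ v (k′ j)
    lowest j<m with locate j<m
    ... | new kg≤ <k = best kg≤ <k
    ... | old {l} l<m eq = subst (λ q → v t ≤ v q) (sym eq) (≤-trans (best ≤-refl k-gap) kg≤kl)
      where
      kg≤kl : v (k g) ≤ v (k l)
      kg≤kl with letters l<m
      ... | inj₁ p≡1 = ≤-reflexive (cong (v ∘ k) (sym (unique l<m p≡1)))
      ... | inj₂ p≡2 = <⇒≤ (order g<m l<m (subst₂ _<_ (sym pg≡1) (sym p≡2) ≤-refl))
    ord : ∀ {i j} → i < m → j < m → p i < p j → v (k′ i) < v (k′ j)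
    ord {i} {j} i<m j<m lt with letters i<m | letters j<m
    ... | inj₁ pi≡1 | inj₁ pj≡1 = contradiction (subst₂ _<_ pi≡1 pj≡1 lt) (<-irrefl refl)
    ... | inj₂ pi≡2 | inj₁ pj≡1 = contradiction (subst₂ _<_ pi≡2 pj≡1 lt) (≤⇒≯ (s≤s z≤n))
    ... | inj₂ pi≡2 | inj₂ pj≡2 = contradiction (subst₂ _<_ pi≡2 pj≡2 lt) (<-irrefl refl)
    ... | inj₁ pi≡1 | inj₂ _ with unique i<m pi≡1
    ...   | refl = ≤∧≢⇒< (subst (λ q → v q ≤ v (k′ j)) (sym k′-g) (lowest j<m))
            (λ eq → <⇒≢ lt (cong p (k′-injective i<m j<m eq)))

  -- Dual to `unique-1`. The maximum is taken over the places after `k g` up to `k (suc g)`, hence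
  -- the composition of `v` with `suc`: position `suc g` lands on `suc t`.
  unique-2 : (∀ {i} → i < m → p i ≡ 1 ⊎ p i ≡ 2) → p (suc g) ≡ 2 →
             (∀ {i} → i < m → p i ≡ 2 → i ≡ suc g) → Result
  unique-2 letters p≡2 unique with extremum (λ x y → ≤-total y x) (λ yx zy → ≤-trans zy yx) (v ∘ suc) k-gap
  ... | t , kg≤t , t<k , best = slid ord
    where
    open Slide kg≤t t<k
    best′ : ∀ {q} → k g < q → q ≤ k (suc g) → v q ≤ v (suc t)
    best′ (s≤s kg≤q) q<k = best kg≤q q<k
    highest-old : ∀ {l} → l < m → v (k l) ≤ v (suc t)
    highest-old l<m with letters l<m
    ... | inj₂ pl≡2 = ≤-trans (≤-reflexive (cong (v ∘ k) (unique l<m pl≡2))) (best′ k-gap ≤-refl)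
    ... | inj₁ pl≡1 = ≤-trans (<⇒≤ (order l<m 1+g<m (subst₂ _<_ (sym pl≡1) (sym p≡2) ≤-refl)))
            (best′ k-gap ≤-refl)
    highest : ∀ {j} → j < m → v (k′ j) ≤ v (suc t)
    highest j<m with locate j<m
    ... | old l<m eq = subst (λ q → v q ≤ v (suc t)) (sym eq) (highest-old l<m)
    ... | new kg≤ <k with m≤n⇒m<n∨m≡n kg≤
    ...   | inj₁ kg< = best′ kg< (<⇒≤ <k)
    ...   | inj₂ kg≡ = subst (λ q → v q ≤ v (suc t)) kg≡ (highest-old g<m)
    ord : ∀ {i j} → i < m → j < m → p i < p j → v (k′ i) < v (k′ j)
    ord {i} {j} i<m j<m lt with letters i<m | letters j<m
    ... | inj₁ pi≡1 | inj₁ pj≡1 = contradiction (subst₂ _<_ pi≡1 pj≡1 lt) (<-irrefl refl)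
    ... | inj₂ pi≡2 | inj₁ pj≡1 = contradiction (subst₂ _<_ pi≡2 pj≡1 lt) (≤⇒≯ (s≤s z≤n))
    ... | inj₂ pi≡2 | inj₂ pj≡2 = contradiction (subst₂ _<_ pi≡2 pj≡2 lt) (<-irrefl refl)
    ... | inj₁ _ | inj₂ pj≡2 with unique j<m pj≡2
    ...   | refl = ≤∧≢⇒< (subst (λ q → v (k′ i) ≤ v q) (sym k′-1+g) (highest i<m))
            (λ eq → <⇒≢ lt (cong p (k′-injective i<m j<m eq)))

-- From dashed words to letter functions

at-∈ : ∀ w {i} → i < length w → at 0 w i ∈ w
at-∈ (x ∷ w) {zero}  _         = here refl
at-∈ (x ∷ w) {suc i} (s≤s i<w) = there (at-∈ w i<w)

∈-at : ∀ {x} {w : List ℕ} → x ∈ w → ∃ λ i → i < length w × at 0 w i ≡ x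
∈-at (here refl) = 0 , s≤s z≤n , refl
∈-at (there x∈w) with ∈-at x∈w
... | i , i<w , eq = suc i , s≤s i<w , eq

-- The positional form of `Once`, which counts by filtering.
Unique-at : ℕ → List ℕ → Set
Unique-at x w = ∃ λ z → z < length w × at 0 w z ≡ x × (∀ {i} → i < length w → at 0 w i ≡ x → i ≡ z)

none⇒filter : ∀ {x} w → (∀ {i} → i < length w → at 0 w i ≢ x) → filter (x ≟_) w ≡ []
none⇒filter []      _    = refl
none⇒filter {x} (y ∷ w) none = trans (filter-reject (x ≟_) (none (s≤s z≤n) ∘ sym))
  (none⇒filter w (none ∘ s≤s))

filter⇒none : ∀ {x} w → length (filter (x ≟_) w) ≡ 0 → ∀ {i} → i < length w → at 0 w i ≢ x
filter⇒none {x} (y ∷ w) len {i} i<w eq with x ≟ y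
... | yes x≡y with trans (cong length (sym (filter-accept (x ≟_) {xs = w} x≡y))) len
...   | ()
filter⇒none {x} (y ∷ w) len {zero} _ eq | no x≢y = x≢y (sym eq)
filter⇒none {x} (y ∷ w) len {suc i} (s≤s i<w) eq | no x≢y =
  filter⇒none w (trans (cong length (sym (filter-reject (x ≟_) x≢y))) len) i<w eq

unique⇒once : ∀ {x} w → Unique-at x w → Once x w
unique⇒once {x} (y ∷ w) (zero , _ , y≡x , unique) =
  trans (cong length (filter-accept (x ≟_) (sym y≡x)))
    (cong (suc ∘ length) (none⇒filter w λ i<w eq → contradiction (unique (s≤s i<w) eq) λ ()))
unique⇒once {x} (y ∷ w) (suc z , s≤s z<w , eq , unique) =
  trans (cong length (filter-reject (x ≟_) λ x≡y → contradiction (unique (s≤s z≤n) (sym x≡y)) λ ()))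
    (unique⇒once w (z , z<w , eq , λ i<w eq′ → suc-injective (unique (s≤s i<w) eq′)))

once⇒unique : ∀ {x} w → Once x w → Unique-at x w
once⇒unique {x} (y ∷ w) once with x ≟ y
... | yes x≡y = 0 , s≤s z≤n , sym x≡y , only
  where
  only : ∀ {i} → i < length (y ∷ w) → at 0 (y ∷ w) i ≡ x → i ≡ 0
  only {zero}  _         _  = refl
  only {suc i} (s≤s i<w) eq = contradiction eq (filter⇒none w
    (suc-injective (trans (cong length (sym (filter-accept (x ≟_) x≡y))) once)) i<w)
... | no x≢y with once⇒unique w (trans (cong length (sym (filter-reject (x ≟_) x≢y))) once)
...   | z , z<w , eq , unique = suc z , s≤s z<w , eq , only
  where
  only : ∀ {i} → i < length (y ∷ w) → at 0 (y ∷ w) i ≡ x → i ≡ suc z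
  only {zero}  _         y≡x = contradiction (sym y≡x) x≢y
  only {suc i} (s≤s i<w) eq′ = cong suc (unique i<w eq′)

at-replicate : ∀ c a {i} → i < a → at 0 (replicate a c) i ≡ c
at-replicate c (suc a) {zero}  _         = refl
at-replicate c (suc a) {suc i} (s≤s i<a) = at-replicate c a i<a

constant⇒replicate : ∀ {c} w → (∀ {i} → i < length w → at 0 w i ≡ c) → w ≡ replicate (length w) c
constant⇒replicate []      _ = refl
constant⇒replicate (x ∷ w) ≡c = cong₂ _∷_ (≡c (s≤s z≤n)) (constant⇒replicate w (≡c ∘ s≤s))

constant⇒snoc : ∀ {c d} x w → (∀ {i} → i < length w → at 0 (x ∷ w) i ≡ c) →
                at 0 (x ∷ w) (length w) ≡ d → x ∷ w ≡ replicate (length w) c ++ d ∷ []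
constant⇒snoc x []      _  refl = refl
constant⇒snoc x (y ∷ w) ≡c ≡d   = cong₂ _∷_ (≡c (s≤s z≤n)) (constant⇒snoc y w (≡c ∘ s≤s) ≡d)

last-at : ∀ σ → last σ ≡ at 0 (toList σ) (length (tail σ))
last-at σ with snocView σ
... | [] ∷ʳ′ y = refl
... | (x ∷ xs) ∷ʳ′ y = at-snoc xs
  where
  at-snoc : ∀ xs → y ≡ at 0 (x ∷ xs ++ y ∷ []) (length (xs ++ y ∷ []))
  at-snoc xs = trans (go xs) (cong (at 0 (x ∷ xs ++ y ∷ [])) (sym (trans (length-++ xs) (+-comm _ 1))))
    where
    go : ∀ xs → y ≡ at 0 (xs ++ y ∷ []) (length xs)
    go []       = refl
    go (x ∷ xs) = go xs

-- Tagged words and the effect of merging two segments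

tags : Segment → List (ℕ × Link)
tags σ = tag (head σ) (tail σ)

toList-++⁺ : ∀ {A : Set} (xs : List A) ys → toList (xs ++⁺ ys) ≡ xs ++ toList ys
toList-++⁺ []       ys = refl
toList-++⁺ (x ∷ xs) ys = cong (x ∷_) (toList-++⁺ xs ys)

tagged-++⁺ : ∀ σs P → tagged (σs ++⁺ P) ≡ concatMap tags σs ++ tagged P
tagged-++⁺ σs P = trans (cong (concatMap tags) (toList-++⁺ σs P)) (concatMap-++ tags σs (toList P))

at-++ʳ : ∀ {A : Set} {d : A} xs ys i → at d (xs ++ ys) (length xs + i) ≡ at d ys i
at-++ʳ []       ys i = refl
at-++ʳ (x ∷ xs) ys i = at-++ʳ xs ys i

letterAt-undash : ∀ T i → at 0 (map proj₁ T) i ≡ letterAt T i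
letterAt-undash []      i       = refl
letterAt-undash (x ∷ T) zero    = refl
letterAt-undash (x ∷ T) (suc i) = letterAt-undash T i

length-tag : ∀ x xs → length (tag x xs) ≡ suc (length xs)
length-tag x []       = refl
length-tag x (y ∷ ys) = cong suc (length-tag y ys)

letter-tag : ∀ x xs R {i} → i ≤ length xs → letterAt (tag x xs ++ R) i ≡ at 0 (x ∷ xs) i
letter-tag x []       R {zero}  _         = refl
letter-tag x (y ∷ ys) R {zero}  _         = refl
letter-tag x (y ∷ ys) R {suc i} (s≤s i≤)  = letter-tag y ys R i≤

link-tag-joined : ∀ x xs R {i} → i < length xs → linkAt (tag x xs ++ R) i ≡ joined
link-tag-joined x (y ∷ ys) R {zero}  _        = refl
link-tag-joined x (y ∷ ys) R {suc i} (s≤s i<) = link-tag-joined y ys R i<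

link-tag-dash : ∀ x xs R → linkAt (tag x xs ++ R) (length xs) ≡ dash
link-tag-dash x []       R = refl
link-tag-dash x (y ∷ ys) R = link-tag-dash y ys R

-- Serves to show that the letter before σ₂, if there is one, is followed by a dash.
Closed : List (ℕ × Link) → Set
Closed T = ∀ R {i} → suc i ≡ length T → linkAt (T ++ R) i ≡ dash

closed-tag : ∀ x xs {T} → Closed T → Closed (tag x xs ++ T)
closed-tag x []           closed R {zero}  _  = refl
closed-tag x []           closed R {suc i} eq = closed R (suc-injective eq)
closed-tag x (y ∷ ys)     closed R {suc i} eq = closed-tag y ys closed R (suc-injective eq)
closed-tag x (y ∷ [])     closed R {zero}  ()
closed-tag x (y ∷ z ∷ zs) closed R {zero}  ()

closed-tags : ∀ σs → Closed (concatMap tags σs)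
closed-tags []             R ()
closed-tags ((x ∷⁺ xs) ∷ σs) = closed-tag x xs (closed-tags σs)

-- U is T with the dash after position d removed.
record Joins (d : ℕ) (T U : List (ℕ × Link)) : Set where
  field
    same-length  : length T ≡ length U
    same-letters : ∀ i → letterAt T i ≡ letterAt U i
    link⇒        : ∀ {i} → linkAt U i ≡ joined → linkAt T i ≡ joined ⊎ i ≡ d
    link⇐        : ∀ {i} → linkAt T i ≡ joined ⊎ i ≡ d → linkAt U i ≡ joined

joins-∷ : ∀ {d T U} x → Joins d T U → Joins (suc d) (x ∷ T) (x ∷ U)
joins-∷ {d} {T} {U} x j = record
  { same-length  = cong suc same-length
  ; same-letters = λ { zero → refl ; (suc i) → same-letters i }
  ; link⇒        = ⇒
  ; link⇐        = ⇐
  }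
  where
  open Joins j
  ⇒ : ∀ {i} → linkAt (x ∷ U) i ≡ joined → linkAt (x ∷ T) i ≡ joined ⊎ i ≡ suc d
  ⇒ {zero}  eq = inj₁ eq
  ⇒ {suc i} eq with link⇒ {i} eq
  ... | inj₁ eq′  = inj₁ eq′
  ... | inj₂ refl = inj₂ refl
  ⇐ : ∀ {i} → linkAt (x ∷ T) i ≡ joined ⊎ i ≡ suc d → linkAt (x ∷ U) i ≡ joined
  ⇐ {zero}  (inj₁ eq)   = eq
  ⇐ {suc i} (inj₁ eq)   = link⇐ {i} (inj₁ eq)
  ⇐ {suc i} (inj₂ refl) = link⇐ {i} (inj₂ refl)

joins-++ : ∀ {d T U} S → Joins d T U → Joins (length S + d) (S ++ T) (S ++ U)
joins-++ []      j = j
joins-++ (x ∷ S) j = joins-∷ x (joins-++ S j)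

-- Merging two segments only changes the tag of the last letter of the first one, at index
-- `length xs`.
joins-tag : ∀ x xs y ys R →
            Joins (length xs) (tag x xs ++ (tag y ys ++ R)) (tag x (xs ++ y ∷ ys) ++ R)
joins-tag x (x′ ∷ xs) y ys R = joins-∷ (x , joined) (joins-tag x′ xs y ys R)
joins-tag x []        y ys R = record
  { same-length  = refl
  ; same-letters = λ { zero → refl ; (suc i) → refl }
  ; link⇒        = λ { {zero} _ → inj₂ refl ; {suc i} eq → inj₁ eq }
  ; link⇐        = λ { {zero} _ → refl ; {suc i} (inj₁ eq) → eq ; {suc i} (inj₂ ()) }
  }

embedding-map : ∀ {m m′ p p′ J J′ n} {R R′ : ℕ → ℕ → Set} → m′ ≡ m → (∀ i → p′ i ≡ p i) →
                (∀ {i} → J′ i → J i) → (∀ {a b} → a < n → b < n → R a b → R′ a b) →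
                Embedding m p J n R → Embedding m′ p′ J′ n R′
embedding-map {R′ = R′} refl p′≡p J′⇒J R⇒R′ E = record
  { k          = k
  ; bounded    = bounded
  ; increasing = increasing
  ; order      = λ {i} {j} i<m j<m lt →
      R⇒R′ (bounded i<m) (bounded j<m) (order i<m j<m (subst₂ _<_ (p′≡p i) (p′≡p j) lt))
  ; adjacent   = λ i<m → adjacent i<m ∘ J′⇒J
  }
  where open Embedding E

module Letters (σ₁ : List Segment) (x₂ : ℕ) (ys₂ : List ℕ) (x₃ : ℕ) (ys₃ : List ℕ) (σ₄ : List Segment) where

  P Q : DashedWord
  P = dashed σ₁ (x₂ ∷⁺ ys₂) (x₃ ∷⁺ ys₃) σ₄
  Q = merged σ₁ (x₂ ∷⁺ ys₂) (x₃ ∷⁺ ys₃) σ₄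

  A C T₂ T₃ T : List (ℕ × Link)
  A  = concatMap tags σ₁
  C  = concatMap tags σ₄
  T₃ = tag x₃ ys₃ ++ C
  T₂ = tag x₂ ys₂ ++ T₃
  T  = tagged P

  T≡ : T ≡ A ++ T₂
  T≡ = tagged-++⁺ σ₁ _

  -- σ₂ fills positions `s` to `g` and σ₃ positions `suc g` to `e`; the lengths added are those of
  -- the tails, so `g` and `e` are last positions.
  m s g e : ℕ
  m = length T
  s = length A
  g = s + length ys₂
  e = suc g + length ys₃

  p : ℕ → ℕ
  p = letterAt T

  J : ℕ → Set
  J i = linkAt T i ≡ joined

  s≤g : s ≤ g
  s≤g = m≤m+n s _

  g<e : g < e
  g<e = m≤m+n (suc g) _

  e<m : e < m
  e<m = ≤-trans (m≤m+n (suc e) (length C)) (≤-reflexive (begin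
    suc (suc ((s + length ys₂) + length ys₃)) + length C
      ≡⟨ cong (λ l → suc (suc l) + length C) (+-assoc s (length ys₂) (length ys₃)) ⟩
    suc (suc (s + (length ys₂ + length ys₃))) + length C
      ≡⟨ cong (_+ length C) (sym (trans (+-suc s _) (cong suc (trans (cong (s +_) (+-suc (length ys₂) _)) (+-suc s _))))) ⟩
    s + (suc (length ys₂) + suc (length ys₃)) + length C
      ≡⟨ +-assoc s _ (length C) ⟩
    s + (suc (length ys₂) + suc (length ys₃) + length C)
      ≡⟨ cong (s +_) (+-assoc (suc (length ys₂)) _ _) ⟩
    s + (suc (length ys₂) + (suc (length ys₃) + length C))
      ≡⟨ cong (s +_) (cong₂ _+_ (sym (length-tag x₂ ys₂)) (cong (_+ length C) (sym (length-tag x₃ ys₃)))) ⟩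
    s + (length (tag x₂ ys₂) + (length (tag x₃ ys₃) + length C))
      ≡⟨ cong (λ l → s + (length (tag x₂ ys₂) + l)) (sym (length-++ (tag x₃ ys₃))) ⟩
    s + (length (tag x₂ ys₂) + length T₃)
      ≡⟨ cong (s +_) (sym (length-++ (tag x₂ ys₂))) ⟩
    s + length T₂
      ≡⟨ sym (length-++ A) ⟩
    length (A ++ T₂)
      ≡⟨ cong length (sym T≡) ⟩
    m ∎))
    where open ≡-Reasoning

  at-σ₂ : ∀ i → at (0 , dash) T (s + i) ≡ at (0 , dash) T₂ i
  at-σ₂ i = trans (cong (λ t → at (0 , dash) t (s + i)) T≡) (at-++ʳ A T₂ i)

  at-σ₃ : ∀ i → at (0 , dash) T (suc g + i) ≡ at (0 , dash) T₃ i
  at-σ₃ i = trans (cong (at (0 , dash) T) shift) (trans (at-σ₂ (suc (length ys₂) + i))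
    (trans (cong (λ l → at (0 , dash) T₂ (l + i)) (sym (length-tag x₂ ys₂))) (at-++ʳ (tag x₂ ys₂) T₃ i)))
    where
    shift : suc g + i ≡ s + (suc (length ys₂) + i)
    shift = trans (cong suc (+-assoc s _ i)) (sym (+-suc s _))

  letter-σ₂ : ∀ {i} → i ≤ length ys₂ → p (s + i) ≡ at 0 (x₂ ∷ ys₂) i
  letter-σ₂ {i} i≤ = trans (cong proj₁ (at-σ₂ i)) (letter-tag x₂ ys₂ T₃ i≤)

  letter-σ₃ : ∀ {i} → i ≤ length ys₃ → p (suc g + i) ≡ at 0 (x₃ ∷ ys₃) i
  letter-σ₃ {i} i≤ = trans (cong proj₁ (at-σ₃ i)) (letter-tag x₃ ys₃ C i≤)

  p-1+g : p (suc g) ≡ x₃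
  p-1+g = trans (cong p (sym (+-identityʳ (suc g)))) (letter-σ₃ z≤n)

  data From (a : ℕ) : ℕ → Set where
    plus : ∀ d → From a (a + d)

  from : ∀ {a i} → a ≤ i → From a i
  from a≤i with m≤n⇒∃[o]m+o≡n a≤i
  ... | d , refl = plus d

  σ₂-letters : ∀ {c} → (∀ {i} → i ≤ length ys₂ → at 0 (x₂ ∷ ys₂) i ≡ c) →
               ∀ {i} → s ≤ i → i ≤ g → p i ≡ c
  σ₂-letters ≡c s≤i i≤g with from s≤i
  ... | plus d = trans (letter-σ₂ d≤) (≡c d≤)
    where d≤ = +-cancelˡ-≤ s d _ i≤g

  σ₃-letters : ∀ {c} → (∀ {i} → i ≤ length ys₃ → at 0 (x₃ ∷ ys₃) i ≡ c) →
               ∀ {i} → g < i → i ≤ e → p i ≡ c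
  σ₃-letters ≡c g<i i≤e with from g<i
  ... | plus d = trans (letter-σ₃ d≤) (≡c d≤)
    where d≤ = +-cancelˡ-≤ (suc g) d _ i≤e

  J₂ : ∀ {i} → s ≤ i → i < g → J i
  J₂ s≤i i<g with from s≤i
  ... | plus d = trans (cong proj₂ (at-σ₂ d))
    (link-tag-joined x₂ ys₂ T₃ (+-cancelˡ-< s d _ i<g))

  J₃ : ∀ {i} → g < i → i < e → J i
  J₃ g<i i<e with from g<i
  ... | plus d = trans (cong proj₂ (at-σ₃ d))
    (link-tag-joined x₃ ys₃ C (+-cancelˡ-< (suc g) d _ i<e))

  dash⇒¬J : ∀ {i} → linkAt T i ≡ dash → ¬ J i
  dash⇒¬J d j with trans (sym d) j
  ... | ()

  ¬Jg : ¬ J g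
  ¬Jg = dash⇒¬J (trans (cong proj₂ (at-σ₂ (length ys₂))) (link-tag-dash x₂ ys₂ T₃))

  ¬Je : ¬ J e
  ¬Je = dash⇒¬J (trans (cong proj₂ (at-σ₃ (length ys₃))) (link-tag-dash x₃ ys₃ C))

  ¬Js : ∀ {i} → suc i ≡ s → ¬ J i
  ¬Js {i} eq = dash⇒¬J (trans (cong (λ t → linkAt t i) T≡) (closed-tags σ₁ T₂ eq))

  U : List (ℕ × Link)
  U = tagged Q

  joins : Joins g T U
  joins = subst₂ (Joins g) (sym T≡) (sym (tagged-++⁺ σ₁ _))
    (joins-++ A (joins-tag x₂ ys₂ x₃ ys₃ C))

  open Joins joins

  J′ : ℕ → Set
  J′ i = J i ⊎ i ≡ g

  embedding-P : ∀ {n π} → Occurrence P {n} π → Embedding m p J n (Below π)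
  embedding-P = occurrence⇒embedding P _

  occurrence-P : ∀ {n π} → Embedding m p J n (Below π) → Occurrence P {n} π
  occurrence-P = embedding⇒occurrence P _

  embedding-Q : ∀ {n π} → Occurrence Q {n} π → Embedding m p J′ n (Below π)
  embedding-Q = embedding-map same-length same-letters link⇐ (λ _ _ b → b) ∘ occurrence⇒embedding Q _

  occurrence-Q : ∀ {n π} → Embedding m p J′ n (Below π) → Occurrence Q {n} π
  occurrence-Q = embedding⇒occurrence Q _
    ∘ embedding-map (sym same-length) (sym ∘ same-letters) link⇒ (λ _ _ b → b)

  Av-P⊆Av-Q : ∀ {x} → Av P x → Av Q x
  Av-P⊆Av-Q avoids = avoids ∘ occurrence-P
    ∘ embedding-map refl (λ _ → refl) inj₁ (λ _ _ b → b) ∘ embedding-Q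

  -- Standardisation keeps strict inequalities of keys, so it turns the embedding into an occurrence
  -- of P. An occurrence of Q is read back with weak inequalities only, since equal keys may have
  -- been ordered either way.
  forced : (∀ {x} → Av Q x → Av P x) → ∀ n (u : ℕ → ℕ) → Embedding m p J n (λ a b → u a < u b) →
           ¬ ¬ Embedding m p J′ n (λ a b → u a ≤ u b)
  forced Q⊆P n u E ¬E′ with values-standardise n u
  ... | π , mono = Q⊆P {n , π}
    (¬E′ ∘ embedding-map refl (λ _ → refl) (λ j → j)
      (λ a<n b<n below → ≮⇒≥ λ lt → <-asym below (mono b<n a<n lt)) ∘ embedding-Q)
    (occurrence-P (embedding-map refl (λ _ → refl) (λ j → j) mono E))

  length-undash : length (undash P) ≡ m
  length-undash = length-map proj₁ T

  letter-∈ : ∀ {i} → i < m → p i ∈ undash P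
  letter-∈ {i} i<m = subst (_∈ undash P) (letterAt-undash T i)
    (at-∈ (undash P) (subst (i <_) (sym length-undash) i<m))

  ∈-letter : ∀ {x} → x ∈ undash P → ∃ λ i → i < m × p i ≡ x
  ∈-letter x∈ with ∈-at x∈
  ... | i , i< , eq = i , subst (i <_) length-undash i< , trans (sym (letterAt-undash T i)) eq

  all-letters : ∀ {S : ℕ → Set} → (∀ {i} → i < m → S (p i)) → All S (undash P)
  all-letters {S} all = All.tabulate λ x∈ → let i , i<m , eq = ∈-letter x∈ in subst S eq (all i<m)

  Only : ℕ → ℕ → Set
  Only x z = z < m × p z ≡ x × (∀ {i} → i < m → p i ≡ x → i ≡ z)

  once⇒only : ∀ {x} → Once x (undash P) → ∃ (Only x)
  once⇒only once with once⇒unique (undash P) once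
  ... | z , z< , eq , unique = z , subst (z <_) length-undash z< ,
    trans (sym (letterAt-undash T z)) eq ,
    λ {i} i<m eq → unique (subst (i <_) (sym length-undash) i<m) (trans (letterAt-undash T i) eq)

  only⇒once : ∀ {x z} → Only x z → Once x (undash P)
  only⇒once {z = z} (z<m , eq , unique) = unique⇒once (undash P)
    (z , subst (z <_) (sym length-undash) z<m , trans (letterAt-undash T z) eq ,
      λ {i} i< eq → unique (subst (i <_) length-undash i<) (trans (sym (letterAt-undash T i)) eq))

-- The six shapes and the two directions

run-letters : ∀ {c x ys} → Run c (x ∷⁺ ys) → ∀ {i} → i ≤ length ys → at 0 (x ∷ ys) i ≡ c
run-letters {c} (a , refl) i≤ = at-replicate c (suc a) (s≤s (≤-trans i≤ (≤-reflexive (length-replicate a))))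

letters-run : ∀ {c x ys} → (∀ {i} → i ≤ length ys → at 0 (x ∷ ys) i ≡ c) → Run c (x ∷⁺ ys)
letters-run {ys = ys} ≡c = length ys , cong₂ _∷⁺_ (≡c z≤n) (constant⇒replicate ys ≡c)

run-single : ∀ {c x ys} → Run c (x ∷⁺ ys) → length ys ≡ 0 → x ∷⁺ ys ≡ [ c ]
run-single (zero , refl) _ = refl

last-letter : ∀ {c d x ys} a → x ∷ ys ≡ replicate a c ++ d ∷ [] → at 0 (x ∷ ys) (length ys) ≡ d
last-letter zero refl = refl
last-letter {ys = []}    (suc zero)    ()
last-letter {ys = []}    (suc (suc a)) ()
last-letter {ys = _ ∷ _} (suc a)       eq = last-letter a (∷-injectiveʳ eq)

∈-pair : ∀ {x a b : ℕ} → x ∈ a ∷ b ∷ [] → x ≡ a ⊎ x ≡ b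
∈-pair (here eq)         = inj₁ eq
∈-pair (there (here eq)) = inj₂ eq

∈-triple : ∀ {x a b c : ℕ} → x ∈ a ∷ b ∷ c ∷ [] → x ≡ a ⊎ x ≡ b ⊎ x ≡ c
∈-triple (here eq)  = inj₁ eq
∈-triple (there x∈) = inj₂ (∈-pair x∈)

Shape : List Segment → Segment → Segment → List Segment → Set
Shape σ₁ σ₂ σ₃ σ₄ = let P′ = undash (dashed σ₁ σ₂ σ₃ σ₄) in
    (Run 1 σ₂ × σ₃ ≡ [ 2 ] × All (_∈ 1 ∷ 2 ∷ []) P′)
  ⊎ (σ₂ ≡ [ 1 ] × Run 2 σ₃ × All (_∈ 1 ∷ 2 ∷ []) P′)
  ⊎ ((∃ λ a → toList σ₂ ≡ replicate (suc a) 2 ++ 1 ∷ []) × Run 2 σ₃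
      × All (_∈ 1 ∷ 2 ∷ []) P′ × Once 1 P′)
  ⊎ (Run 1 σ₂ × (∃ λ a → toList σ₃ ≡ 2 ∷ replicate (suc a) 1)
      × All (_∈ 1 ∷ 2 ∷ []) P′ × Once 2 P′)
  ⊎ (Run 1 σ₂ × σ₃ ≡ [ 3 ] × All (_∈ 1 ∷ 2 ∷ 3 ∷ []) P′ × Once 2 P′)
  ⊎ (σ₂ ≡ [ 1 ] × Run 3 σ₃ × All (_∈ 1 ∷ 2 ∷ 3 ∷ []) P′ × Once 2 P′)

module _ (σ₁ : List Segment) (x₂ : ℕ) (ys₂ : List ℕ) (x₃ : ℕ) (ys₃ : List ℕ) (σ₄ : List Segment) where

  open Letters σ₁ x₂ ys₂ x₃ ys₃ σ₄

  private
    σ₂ σ₃ : Segment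
    σ₂ = x₂ ∷⁺ ys₂
    σ₃ = x₃ ∷⁺ ys₃

  module _ {n} π (E : Embedding m p J n (Below {n} π)) where
    open If s≤g g<e e<m J₂ J₃ ¬Js ¬Je (values-injective π) E public

  equal-classes : (∀ {n} π → Embedding m p J n (Below {n} π) → Embedding m p J′ n (Below {n} π)) →
                  Av P ≐ Av Q
  equal-classes transfer = Av-P⊆Av-Q , λ {x} avoids → avoids ∘ occurrence-Q ∘ transfer (proj₂ x) ∘ embedding-P

  single-σ₂ : σ₂ ≡ [ 1 ] → s ≡ g
  single-σ₂ refl = sym (+-identityʳ s)

  single-σ₃ : ∀ {c} → σ₃ ≡ [ c ] → e ≡ suc g
  single-σ₃ refl = +-identityʳ (suc g)

  shape⇒equal : Shape σ₁ σ₂ σ₃ σ₄ → Av P ≐ Av Q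
  shape⇒equal (inj₁ (run₂ , eq₃ , all)) = equal-classes λ π E →
    two-letters π E (∈-pair ∘ All.lookup all ∘ letter-∈) (σ₂-letters (run-letters run₂))
      (σ₃-letters (run-letters (0 , eq₃))) (inj₂ (single-σ₃ eq₃))
  shape⇒equal (inj₂ (inj₁ (eq₂ , run₃ , all))) = equal-classes λ π E →
    two-letters π E (∈-pair ∘ All.lookup all ∘ letter-∈) (σ₂-letters (run-letters (0 , eq₂)))
      (σ₃-letters (run-letters run₃)) (inj₁ (single-σ₂ eq₂))
  shape⇒equal (inj₂ (inj₂ (inj₁ ((a , eq₂) , run₃ , all , once)))) = equal-classes λ π E →
    unique-1 π E (∈-pair ∘ All.lookup all ∘ letter-∈) pg≡1 unique
    where
    pg≡1 : p g ≡ 1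
    pg≡1 = trans (letter-σ₂ ≤-refl) (last-letter (suc a) eq₂)
    unique : ∀ {i} → i < m → p i ≡ 1 → i ≡ g
    unique i<m eq = let _ , _ , _ , u = once⇒only once in
      trans (u i<m eq) (sym (u (<-trans g<e e<m) pg≡1))
  shape⇒equal (inj₂ (inj₂ (inj₂ (inj₁ (run₂ , (a , eq₃) , all , once))))) = equal-classes λ π E →
    unique-2 π E (∈-pair ∘ All.lookup all ∘ letter-∈) p≡2 unique
    where
    p≡2 : p (suc g) ≡ 2
    p≡2 = trans p-1+g (∷-injectiveˡ eq₃)
    unique : ∀ {i} → i < m → p i ≡ 2 → i ≡ suc g
    unique i<m eq = let _ , _ , _ , u = once⇒only once in
      trans (u i<m eq) (sym (u (≤-<-trans g<e e<m) p≡2))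
  shape⇒equal (inj₂ (inj₂ (inj₂ (inj₂ (inj₁ (run₂ , eq₃ , all , once)))))) = equal-classes λ π E →
    let _ , z<m , pz≡2 , u = once⇒only once in
    three-letters π E (∈-triple ∘ All.lookup all ∘ letter-∈) z<m pz≡2 u (σ₂-letters (run-letters run₂))
      (σ₃-letters (run-letters (0 , eq₃))) (inj₂ (single-σ₃ eq₃))
  shape⇒equal (inj₂ (inj₂ (inj₂ (inj₂ (inj₂ (eq₂ , run₃ , all , once)))))) = equal-classes λ π E →
    let _ , z<m , pz≡2 , u = once⇒only once in
    three-letters π E (∈-triple ∘ All.lookup all ∘ letter-∈) z<m pz≡2 u (σ₂-letters (run-letters (0 , eq₂)))
      (σ₃-letters (run-letters run₃)) (inj₁ (single-σ₂ eq₂))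

  run-σ₂ : ∀ {c} → (∀ {i} → s ≤ i → i ≤ g → p i ≡ c) → Run c σ₂
  run-σ₂ ≡c = letters-run λ {i} i≤ →
    trans (sym (letter-σ₂ i≤)) (≡c (m≤m+n s i) (+-monoʳ-≤ s i≤))

  run-σ₃ : ∀ {c} → (∀ {i} → g < i → i ≤ e → p i ≡ c) → Run c σ₃
  run-σ₃ ≡c = letters-run λ {i} i≤ →
    trans (sym (letter-σ₃ i≤)) (≡c (m≤m+n (suc g) i) (+-monoʳ-≤ (suc g) i≤))

  -- Nontriviality gives `1 < r`, and `last σ₂ ≤ head σ₃` lets `extremes` fix these letters as 1 and
  -- `r`. Then r = 2 leads to (1)-(4), and larger `r` to (5) and (6).
  equal⇒shape : IsPattern P → Nontrivial P → last σ₂ ≤ head σ₃ → Av P ≐ Av Q → Shape σ₁ σ₂ σ₃ σ₄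
  equal⇒shape (r , isPattern) nontrivial last≤head (_ , Q⊆P) = by-size (r ≟ 2)
    where
    bounds : ∀ {i} → i < m → 1 ≤ p i × p i ≤ r
    bounds i<m = Equivalence.to (isPattern _) (letter-∈ i<m)

    1<r : 1 < r
    1<r with 1 <? r
    ... | yes 1<r = 1<r
    ... | no  1≮r = contradiction (all-letters λ i<m → let 1≤p , p≤r = bounds i<m in
          ≤-antisym (≤-trans p≤r (≮⇒≥ 1≮r)) 1≤p) nontrivial

    open OnlyIf s≤g g<e e<m J₂ J₃ ¬Jg (forced Q⊆P) (proj₁ ∘ bounds) (proj₂ ∘ bounds)
      (λ 1≤c c≤r → ∈-letter (Equivalence.from (isPattern _) (1≤c , c≤r))) 1<r

    ends : p g ≡ 1 × p (suc g) ≡ r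
    ends = extremes (subst₂ _≤_ (trans (last-at σ₂) (sym (letter-σ₂ ≤-refl))) (sym p-1+g) last≤head)

    open Tight (proj₁ ends) (proj₂ ends)

    Constant₂ Constant₃ : ℕ → Set
    Constant₂ c = ∀ {i} → s ≤ i → i ≤ g → p i ≡ c
    Constant₃ c = ∀ {i} → suc g ≤ i → i ≤ e → p i ≡ c

    one-short : Constant₂ 1 → Constant₃ r → (Run 1 σ₂ × σ₃ ≡ [ r ]) ⊎ (σ₂ ≡ [ 1 ] × Run r σ₃)
    one-short const₂ const₃ with m≤n⇒m<n∨m≡n s≤g | m≤n⇒m<n∨m≡n g<e
    ... | inj₂ s≡g | _ = inj₂ (run-single (run-σ₂ const₂)
            (+-cancelˡ-≡ s _ 0 (trans (sym s≡g) (sym (+-identityʳ s)))) , run-σ₃ const₃)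
    ... | inj₁ _ | inj₂ 1+g≡e = inj₁ (run-σ₂ const₂ , run-single (run-σ₃ const₃)
            (+-cancelˡ-≡ (suc g) _ 0 (trans (sym 1+g≡e) (sym (+-identityʳ (suc g))))))
    ... | inj₁ s<g | inj₁ 1+g<e with predecessor s<g
    ...   | h , 1+h≡g , s≤h = ⊥-elim (not-both-long s≤h 1+h≡g
            (const₂ s≤h (≤-trans (n≤1+n h) (≤-reflexive 1+h≡g))) 1+g<e (const₃ (n≤1+n _) 1+g<e))

    by-size : Dec (r ≡ 2) → Shape σ₁ σ₂ σ₃ σ₄
    by-size (no r≢2) = three-shape
      where
      2<r : 2 < r
      2<r = ≤∧≢⇒< 1<r (r≢2 ∘ sym)
      open ThreeLetters 2<r
      three-shape : Shape σ₁ σ₂ σ₃ σ₄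
      three-shape with ∈-letter (Equivalence.from (isPattern 2) (s≤s z≤n , <⇒≤ 2<r))
      ... | z , z<m , pz≡2 = inj₂ (inj₂ (inj₂ (inj₂
        ([ (λ { (run₂ , eq₃) → inj₁ (run₂ , trans eq₃ (cong [_] r≡3) , all , once) }) ,
           (λ { (eq₂ , run₃) → inj₂ (eq₂ , subst (λ c → Run c σ₃) r≡3 run₃ , all , once) }) ]′
         (one-short const₂ const₃)))))
        where
        const₂ : Constant₂ 1
        const₂ s≤i i≤g = descend (λ i → p i ≡ 1) i≤g (proj₁ ends)
          λ i≤l l<g → σ₂-constant-step z<m pz≡2 r≡3 (≤-trans s≤i i≤l) l<g
        const₃ : Constant₃ r
        const₃ g<i i≤e = ascend (λ i → p i ≡ r) g<i (proj₂ ends)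
          λ g<l l<i → σ₃-constant-step z<m pz≡2 g<l (<-≤-trans l<i i≤e)
        once : Once 2 (undash P)
        once = only⇒once (z<m , pz≡2 , λ i<m p≡2 → middle-unique z<m pz≡2 i<m
          (subst (1 <_) (sym p≡2) ≤-refl) (subst (_< r) (sym p≡2) 2<r))
        all : All (_∈ 1 ∷ 2 ∷ 3 ∷ []) (undash P)
        all = all-letters λ {i} i<m → upto-3 (p i) (proj₁ (bounds i<m)) (subst (p i ≤_) r≡3 (proj₂ (bounds i<m)))
          where
          upto-3 : ∀ c → 1 ≤ c → c ≤ 3 → c ∈ 1 ∷ 2 ∷ 3 ∷ []
          upto-3 1 _ _ = here refl
          upto-3 2 _ _ = there (here refl)
          upto-3 3 _ _ = there (there (here refl))
          upto-3 (suc (suc (suc (suc _)))) _ (s≤s (s≤s (s≤s ())))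
    by-size (yes r≡2) = two-shape σ₂-shape σ₃-shape
      where
      open TwoLetters r≡2
      all : All (_∈ 1 ∷ 2 ∷ []) (undash P)
      all = all-letters λ i<m → [ here , there ∘ here ]′ (letter-1∨2 i<m)
      g<m : g < m
      g<m = <-trans g<e e<m
      two-shape : Constant₂ 1 ⊎ (s < g × (∀ {i} → i < m → p i ≡ 1 → i ≡ g)) →
                  Constant₃ 2 ⊎ (suc g < e × (∀ {i} → i < m → p i ≡ 2 → i ≡ suc g)) →
                  Shape σ₁ σ₂ σ₃ σ₄
      two-shape (inj₁ const₂) (inj₁ const₃)
        with one-short const₂ (λ g<i i≤e → trans (const₃ g<i i≤e) (sym r≡2))
      ... | inj₁ (run₂ , eq₃) = inj₁ (run₂ , trans eq₃ (cong [_] r≡2) , all)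
      ... | inj₂ (eq₂ , run₃) = inj₂ (inj₁ (eq₂ , subst (λ c → Run c σ₃) r≡2 run₃ , all))
      two-shape (inj₁ const₂) (inj₂ (1+g<e , unique)) = inj₂ (inj₂ (inj₂ (inj₁
        (run-σ₂ const₂ , tail-σ₃ , all , only⇒once (≤-<-trans g<e e<m , trans (proj₂ ends) r≡2 , unique)))))
        where
        ones : ∀ {i} → i < length ys₃ → at 0 ys₃ i ≡ 1
        ones {i} i< = trans (sym (letter-σ₃ i<)) ([ (λ p≡1 → p≡1) , (λ p≡2 → contradiction
          (unique i<m p≡2) (λ eq → 1+n≢0 (+-cancelˡ-≡ (suc g) (suc i) 0 (trans eq (sym (+-identityʳ _)))))) ]′
          (letter-1∨2 i<m))
          where
          i<m : suc g + suc i < m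
          i<m = ≤-<-trans (+-monoʳ-≤ (suc g) i<) e<m
        tail-σ₃ : ∃ λ a → x₃ ∷ ys₃ ≡ 2 ∷ replicate (suc a) 1
        tail-σ₃ with predecessor (+-cancelˡ-< (suc g) 0 (length ys₃) (subst (_< e) (sym (+-identityʳ _)) 1+g<e))
        ... | a , eq , _ = a , cong₂ _∷_ (trans (sym p-1+g) (trans (proj₂ ends) r≡2))
              (trans (constant⇒replicate ys₃ ones) (cong (λ l → replicate l 1) (sym eq)))
      two-shape (inj₂ (s<g , unique)) (inj₁ const₃) = inj₂ (inj₂ (inj₁
        (init-σ₂ , run-σ₃ const₃ , all , only⇒once (g<m , proj₁ ends , unique))))
        where
        twos : ∀ {i} → i < length ys₂ → at 0 (x₂ ∷ ys₂) i ≡ 2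
        twos {i} i< = trans (sym (letter-σ₂ (<⇒≤ i<))) ([ (λ p≡1 → contradiction
          (unique i<m p≡1) (λ eq → <⇒≢ i< (+-cancelˡ-≡ s _ _ eq))) , (λ p≡2 → p≡2) ]′
          (letter-1∨2 i<m))
          where
          i<m : s + i < m
          i<m = <-trans (+-monoʳ-< s i<) g<m
        init-σ₂ : ∃ λ a → x₂ ∷ ys₂ ≡ replicate (suc a) 2 ++ 1 ∷ []
        init-σ₂ with predecessor (+-cancelˡ-< s 0 (length ys₂) (subst (_< g) (sym (+-identityʳ s)) s<g))
        ... | a , eq , _ = a , trans (constant⇒snoc x₂ ys₂ twos (trans (sym (letter-σ₂ ≤-refl)) (proj₁ ends)))
              (cong (λ l → replicate l 2 ++ 1 ∷ []) (sym eq))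
      -- The letter at `s` is 1 or 2, yet the only 1 is at `g` and the only 2 at `suc g`, both after
      -- `s`.
      two-shape (inj₂ (s<g , unique-1)) (inj₂ (1+g<e , unique-2))
        with letter-1∨2 (<-trans s<g g<m)
      ... | inj₁ p≡1 = contradiction (unique-1 (<-trans s<g g<m) p≡1) (<⇒≢ s<g)
      ... | inj₂ p≡2 = contradiction (unique-2 (<-trans s<g g<m) p≡2) (<⇒≢ (m≤n⇒m≤1+n s<g))

proposition1 :
  (σ₁ : List Segment) (σ₂ σ₃ : Segment) (σ₄ : List Segment) →
  let P  = dashed σ₁ σ₂ σ₃ σ₄
      Q  = merged σ₁ σ₂ σ₃ σ₄
      P′ = undash P
  in
  IsPattern P → IsPattern Q → Nontrivial P → Nontrivial Q →
  last σ₂ ≤ head σ₃ →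
  (Av P ≐ Av Q) ⇔
    ( (Run 1 σ₂ × σ₃ ≡ [ 2 ] × All (_∈ 1 ∷ 2 ∷ []) P′)
    ⊎ (σ₂ ≡ [ 1 ] × Run 2 σ₃ × All (_∈ 1 ∷ 2 ∷ []) P′)
    ⊎ ((∃ λ a → toList σ₂ ≡ replicate (suc a) 2 ++ 1 ∷ []) × Run 2 σ₃
        × All (_∈ 1 ∷ 2 ∷ []) P′ × Once 1 P′)
    ⊎ (Run 1 σ₂ × (∃ λ a → toList σ₃ ≡ 2 ∷ replicate (suc a) 1)
        × All (_∈ 1 ∷ 2 ∷ []) P′ × Once 2 P′)
    ⊎ (Run 1 σ₂ × σ₃ ≡ [ 3 ] × All (_∈ 1 ∷ 2 ∷ 3 ∷ []) P′ × Once 2 P′)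
    ⊎ (σ₂ ≡ [ 1 ] × Run 3 σ₃ × All (_∈ 1 ∷ 2 ∷ 3 ∷ []) P′ × Once 2 P′)
    )
proposition1 σ₁ (x₂ ∷⁺ ys₂) (x₃ ∷⁺ ys₃) σ₄ isPattern _ nontrivial _ last≤head = mk⇔
  (equal⇒shape σ₁ x₂ ys₂ x₃ ys₃ σ₄ isPattern nontrivial last≤head)
  (shape⇒equal σ₁ x₂ ys₂ x₃ ys₃ σ₄)
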